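{- Let $\mathbf{d}=(d_0,d_1,d_2,\ldots)$ be the period-doubling sequence. For every positive integer $k$, the $t$-Hankel determinant $H_k(\mathbf{d},t)$ is a polynomial in $t$ of degree $k$ whose leading coefficient is the only one of its coefficients that is an odd integer. In other words, $$H_k(\mathbf{d},t)\equiv t^k \pmod 2.$$
   Context: The Thue--Morse sequence $\mathbf{e}=(e_0,e_1,\ldots)$ is defined by $\sum_{k\ge0}e_kx^k=\prod_{k\ge0}(1-x^{2^k})$. The period-doubling sequence $\mathbf{d}$ is defined by $d_k=\frac12|e_k-e_{k+1}|$ for $k\ge0$, so $\mathbf{d}=(1,0,1,1,1,0,\ldots)$. For a sequence $\mathbf{c}=(c_0,c_1,\ldots)$, a parameter $t$ and $k\ge1$, the $t$-Hankel determinant is $H_k(\mathbf{c},t)=\det(a_{ij})_{0\le i,j\le k-1}$ where $a_{ij}=c_{i+j}$ for $i\ne j$ and $a_{ii}=c_{2i}\,t$ (i.e. the ordinary Hankel determinant with every diagonal entry multiplied by $t$). A congruence of polynomials modulo $2$ means coefficientwise congruence. -}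

module Defs where

open import Algebra.Bundles.Raw using (RawRing)
import Algebra.Definitions.RawSemiring as RawSemiringDefs
open import Data.Bool.Base using (if_then_else_)
open import Data.Fin.Base using (Fin; zero; suc; toℕ; punchIn)
open import Data.Fin.Properties using (_≟_)
open import Data.Integer.Base as ℤ using (ℤ; +_; 0ℤ; 1ℤ; -1ℤ; ∣_∣)
import Data.Integer.Divisibility as ℤ
import Data.Integer.Properties as ℤ
open import Data.List.Base using (List; []; _∷_; [_]; map)
open import Data.Nat.Base as ℕ using (ℕ; zero; suc; _<_; _≤_; _∸_; z≤n; s≤s)
import Data.Nat.DivMod as ℕ
import Data.Nat.Properties as ℕ
open import Data.Product.Base using (_×_; _,_)
open import Data.Sum.Base using (_⊎_; inj₁; inj₂)
open import Level using (0ℓ)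
open import Relation.Binary.PropositionalEquality
  using (_≡_; _≢_; refl; sym; trans; cong; cong₂; subst; subst₂)
open import Relation.Nullary.Decidable using (does)
open import Relation.Nullary.Negation using (¬_)

-- A polynomial is its list of coefficients, constant term first.  Trailing
-- zeros are allowed, so equality is coefficientwise rather than _≡_.

Poly : Set
Poly = List ℤ

coeff : Poly → ℕ → ℤ
coeff []      _       = 0ℤ
coeff (a ∷ p) zero    = a
coeff (a ∷ p) (suc n) = coeff p n

_+ₚ_ : Poly → Poly → Poly
[]      +ₚ q       = q
(a ∷ p) +ₚ []      = a ∷ p
(a ∷ p) +ₚ (b ∷ q) = (a ℤ.+ b) ∷ (p +ₚ q)

-ₚ_ : Poly → Poly
-ₚ p = map (λ a → ℤ.- a) p

_*ₚ_ : Poly → Poly → Poly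
[]      *ₚ q = []
(a ∷ p) *ₚ q = map (a ℤ.*_) q +ₚ (0ℤ ∷ (p *ₚ q))

polyRawRing : RawRing 0ℓ 0ℓ
polyRawRing = record
  { Carrier = Poly
  ; _≈_     = λ p q → ∀ n → coeff p n ≡ coeff q n
  ; _+_     = _+ₚ_
  ; _*_     = _*ₚ_
  ; -_      = -ₚ_
  ; 0#      = []
  ; 1#      = [ 1ℤ ]
  }

open RawSemiringDefs (RawRing.rawSemiring polyRawRing) public
  using () renaming (_^_ to _^ₚ_)

const : ℤ → Poly
const a = [ a ]

X : Poly
X = 0ℤ ∷ 1ℤ ∷ []

HasDegree : Poly → ℕ → Set
HasDegree p n = coeff p n ≢ 0ℤ × (∀ m → n < m → coeff p m ≡ 0ℤ)

Odd : ℤ → Set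
Odd a = ¬ (+ 2 ℤ.∣ a)

infix 4 _≡_[mod_]

_≡_[mod_] : Poly → Poly → ℤ → Set
p ≡ q [mod m ] = ∀ n → m ℤ.∣ (coeff p n ℤ.- coeff q n)

module _ {c ℓ} (R : RawRing c ℓ) where
  open RawRing R
  open RawSemiringDefs rawSemiring using (sum; _^_)

  -- Laplace expansion along the first row.
  det : ∀ {n} → (Fin n → Fin n → Carrier) → Carrier
  det {zero}  M = 1#
  det {suc n} M = sum λ j →
    (- 1#) ^ toℕ j * (M zero j * det λ r s → M (suc r) (punchIn j s))

tHankelMatrix : (ℕ → ℤ) → (k : ℕ) → Fin k → Fin k → Poly
tHankelMatrix c k i j =
  if does (i ≟ j) then const (c (toℕ i ℕ.+ toℕ j)) *ₚ X
                  else const (c (toℕ i ℕ.+ toℕ j))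

-- Hₖ(c, t) as a polynomial in the indeterminate t = X.
tHankelDet : (ℕ → ℤ) → ℕ → Poly
tHankelDet c k = det polyRawRing (tHankelMatrix c k)

-- ∏_{k < m} (1 − x^(2^k))
thueMorseProduct : ℕ → Poly
thueMorseProduct zero    = [ 1ℤ ]
thueMorseProduct (suc m) =
  ([ 1ℤ ] +ₚ (-ₚ (X ^ₚ (2 ℕ.^ m)))) *ₚ thueMorseProduct m

-- The coefficient of xⁿ in the infinite product is already that of the partial
-- product over k ≤ n; see thueMorse-stable.
thueMorse : ℕ → ℤ
thueMorse n = coeff (thueMorseProduct (suc n)) n

-- The division by 2 is exact; see periodDoubling-exact.
periodDoubling : ℕ → ℤ
periodDoubling k = + (∣ thueMorse k ℤ.- thueMorse (suc k) ∣ ℕ./ 2)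

module Lemmas where
  coeff-+ : ∀ p q n → coeff (p +ₚ q) n ≡ coeff p n ℤ.+ coeff q n
  coeff-+ []      q       n       = sym (ℤ.+-identityˡ _)
  coeff-+ (a ∷ p) []      n       = sym (ℤ.+-identityʳ _)
  coeff-+ (a ∷ p) (b ∷ q) zero    = refl
  coeff-+ (a ∷ p) (b ∷ q) (suc n) = coeff-+ p q n

  coeff-neg : ∀ p n → coeff (-ₚ p) n ≡ ℤ.- coeff p n
  coeff-neg []      n       = refl
  coeff-neg (a ∷ p) zero    = refl
  coeff-neg (a ∷ p) (suc n) = coeff-neg p n

  coeff-scale : ∀ a p n → coeff (map (a ℤ.*_) p) n ≡ a ℤ.* coeff p n
  coeff-scale a []      n       = sym (ℤ.*-zeroʳ a)
  coeff-scale a (b ∷ p) zero    = refl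
  coeff-scale a (b ∷ p) (suc n) = coeff-scale a p n

  coeff-∷* : ∀ a p q n →
    coeff ((a ∷ p) *ₚ q) n ≡ a ℤ.* coeff q n ℤ.+ coeff (0ℤ ∷ (p *ₚ q)) n
  coeff-∷* a p q n = trans (coeff-+ (map (a ℤ.*_) q) _ n)
    (cong (ℤ._+ coeff (0ℤ ∷ (p *ₚ q)) n) (coeff-scale a q n))

  0*-lemma : ∀ p q → (∀ n → coeff p n ≡ 0ℤ) → ∀ n → coeff (p *ₚ q) n ≡ 0ℤ
  0*-lemma []      q h n = refl
  0*-lemma (a ∷ p) q h n = trans (coeff-∷* a p q n)
    (cong₂ ℤ._+_ (cong (ℤ._* coeff q n) (h 0)) (tail n))
    where
    tail : ∀ n → coeff (0ℤ ∷ (p *ₚ q)) n ≡ 0ℤ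
    tail zero    = refl
    tail (suc n) = 0*-lemma p q (λ i → h (suc i)) n

  *-congˡ : ∀ p p′ q → (∀ n → coeff p n ≡ coeff p′ n) →
            ∀ n → coeff (p *ₚ q) n ≡ coeff (p′ *ₚ q) n
  *-congˡ []      p′       q h n = sym (0*-lemma p′ q (λ i → sym (h i)) n)
  *-congˡ (a ∷ p) []       q h n = 0*-lemma (a ∷ p) q h n
  *-congˡ (a ∷ p) (b ∷ p′) q h n = trans (coeff-∷* a p q n) (trans
    (cong₂ ℤ._+_ (cong (ℤ._* coeff q n) (h 0)) (tail n))
    (sym (coeff-∷* b p′ q n)))
    where
    tail : ∀ n → coeff (0ℤ ∷ (p *ₚ q)) n ≡ coeff (0ℤ ∷ (p′ *ₚ q)) n
    tail zero    = refl
    tail (suc n) = *-congˡ p p′ q (λ i → h (suc i)) n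

  mono : ℤ → ℕ → Poly
  mono a zero    = [ a ]
  mono a (suc N) = 0ℤ ∷ mono a N

  coeff-X* : ∀ p n → coeff (X *ₚ p) n ≡ coeff (0ℤ ∷ p) n
  coeff-X* p zero    = coeff-∷* 0ℤ [ 1ℤ ] p 0
  coeff-X* p (suc n) = trans (coeff-∷* 0ℤ [ 1ℤ ] p (suc n))
    (trans (ℤ.+-identityˡ _) (trans (coeff-∷* 1ℤ [] p n)
    (trans (cong₂ ℤ._+_ (ℤ.*-identityˡ (coeff p n)) (nil n)) (ℤ.+-identityʳ _))))
    where
    nil : ∀ n → coeff (0ℤ ∷ []) n ≡ 0ℤ
    nil zero    = refl
    nil (suc n) = refl

  coeff-X^ : ∀ N n → coeff (X ^ₚ N) n ≡ coeff (mono 1ℤ N) n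
  coeff-X^ zero    n       = refl
  coeff-X^ (suc N) zero    = coeff-X* (X ^ₚ N) 0
  coeff-X^ (suc N) (suc n) = trans (coeff-X* (X ^ₚ N) (suc n)) (coeff-X^ N n)

  coeff-neg-mono : ∀ N n → ℤ.- coeff (mono 1ℤ N) n ≡ coeff (mono -1ℤ N) n
  coeff-neg-mono zero    zero    = refl
  coeff-neg-mono zero    (suc n) = refl
  coeff-neg-mono (suc N) zero    = refl
  coeff-neg-mono (suc N) (suc n) = coeff-neg-mono N n

  mono*-below : ∀ a N q n → n < N → coeff (mono a N *ₚ q) n ≡ 0ℤ
  mono*-below a (suc N) q zero    _       = coeff-∷* 0ℤ (mono a N) q 0
  mono*-below a (suc N) q (suc n) (s≤s l) = trans
    (coeff-∷* 0ℤ (mono a N) q (suc n))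
    (trans (ℤ.+-identityˡ _) (mono*-below a N q n l))

  mono*-above : ∀ a N q n → coeff (mono a N *ₚ q) (N ℕ.+ n) ≡ a ℤ.* coeff q n
  mono*-above a zero    q zero    = trans (coeff-∷* a [] q 0) (ℤ.+-identityʳ _)
  mono*-above a zero    q (suc n) =
    trans (coeff-∷* a [] q (suc n)) (ℤ.+-identityʳ _)
  mono*-above a (suc N) q n       = trans
    (coeff-∷* 0ℤ (mono a N) q (suc (N ℕ.+ n)))
    (trans (ℤ.+-identityˡ _) (mono*-above a N q n))

  factor* : ∀ N q n → coeff (([ 1ℤ ] +ₚ (-ₚ (X ^ₚ suc N))) *ₚ q) n
    ≡ coeff q n ℤ.+ coeff (mono -1ℤ (suc N) *ₚ q) n
  factor* N q n = trans
    (*-congˡ ([ 1ℤ ] +ₚ (-ₚ (X ^ₚ suc N))) (1ℤ ∷ mono -1ℤ N) q h n)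
    (trans (coeff-∷* 1ℤ (mono -1ℤ N) q n)
    (cong₂ ℤ._+_ (ℤ.*-identityˡ (coeff q n)) (sym (trans
      (coeff-∷* 0ℤ (mono -1ℤ N) q n) (ℤ.+-identityˡ _)))))
    where
    h₀ : ∀ n → coeff (-ₚ (X ^ₚ suc N)) n ≡ coeff (mono -1ℤ (suc N)) n
    h₀ n = trans (coeff-neg (X ^ₚ suc N) n)
      (trans (cong (λ z → ℤ.- z) (coeff-X^ (suc N) n)) (coeff-neg-mono (suc N) n))
    h : ∀ n → coeff ([ 1ℤ ] +ₚ (-ₚ (X ^ₚ suc N))) n ≡ coeff (1ℤ ∷ mono -1ℤ N) n
    h zero    = trans (coeff-+ [ 1ℤ ] (-ₚ (X ^ₚ suc N)) 0)
                      (cong (λ z → 1ℤ ℤ.+ z) (h₀ 0))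
    h (suc n) = trans (coeff-+ [ 1ℤ ] (-ₚ (X ^ₚ suc N)) (suc n))
      (trans (ℤ.+-identityˡ _) (h₀ (suc n)))

  factor-below : ∀ N .{{_ : ℕ.NonZero N}} q n → n < N →
    coeff (([ 1ℤ ] +ₚ (-ₚ (X ^ₚ N))) *ₚ q) n ≡ coeff q n
  factor-below (suc N) q n l = trans (factor* N q n)
    (trans (cong (λ z → coeff q n ℤ.+ z) (mono*-below -1ℤ (suc N) q n l)) (ℤ.+-identityʳ _))

  factor-above : ∀ N .{{_ : ℕ.NonZero N}} q n →
    coeff (([ 1ℤ ] +ₚ (-ₚ (X ^ₚ N))) *ₚ q) (N ℕ.+ n)
    ≡ coeff q (N ℕ.+ n) ℤ.- coeff q n
  factor-above (suc N) q n = trans (factor* N q (suc N ℕ.+ n))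
    (cong (λ z → coeff q (suc N ℕ.+ n) ℤ.+ z)
      (trans (mono*-above -1ℤ (suc N) q n) (ℤ.-1*i≡-i (coeff q n))))

  2^≢0 : ∀ m → ℕ.NonZero (2 ℕ.^ m)
  2^≢0 m = ℕ.m^n≢0 2 m

  n<2^n : ∀ n → n < 2 ℕ.^ n
  n<2^n zero    = s≤s z≤n
  n<2^n (suc n) = ℕ.≤-trans (ℕ.+-mono-≤ (ℕ.m^n>0 2 n) (n<2^n n))
    (ℕ.≤-reflexive (cong (2 ℕ.^ n ℕ.+_) (sym (ℕ.+-identityʳ _))))

  n<m⇒n<2^m : ∀ {n m} → n ≤ m → n < 2 ℕ.^ m
  n<m⇒n<2^m {n} {m} l = ℕ.≤-<-trans l (n<2^n m)

  stable-+ : ∀ n j → coeff (thueMorseProduct (j ℕ.+ suc n)) n ≡ thueMorse n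
  stable-+ n zero    = refl
  stable-+ n (suc j) = trans
    (factor-below (2 ℕ.^ (j ℕ.+ suc n)) {{2^≢0 (j ℕ.+ suc n)}} (thueMorseProduct (j ℕ.+ suc n)) n
      (n<m⇒n<2^m (ℕ.≤-trans (ℕ.n≤1+n n) (ℕ.m≤n+m (suc n) j))))
    (stable-+ n j)

  split : ∀ m n → (n < m) ⊎ (m ℕ.+ (n ∸ m) ≡ n)
  split m n with ℕ.<-≤-connex n m
  ... | inj₁ l = inj₁ l
  ... | inj₂ l = inj₂ (ℕ.m+[n∸m]≡n l)

  zero-above : ∀ m n → coeff (thueMorseProduct m) (2 ℕ.^ m ℕ.+ n) ≡ 0ℤ
  zero-above zero    n = refl
  zero-above (suc m) n = trans
    (cong (coeff (thueMorseProduct (suc m))) eq)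
    (trans (factor-above N {{2^≢0 m}} P (N ℕ.+ n))
      (cong₂ ℤ._-_ (zero-above m (N ℕ.+ n)) (zero-above m n)))
    where
    N = 2 ℕ.^ m
    P = thueMorseProduct m
    eq : (N ℕ.+ (N ℕ.+ 0)) ℕ.+ n ≡ N ℕ.+ (N ℕ.+ n)
    eq = trans (cong (λ z → (N ℕ.+ z) ℕ.+ n) (ℕ.+-identityʳ N)) (ℕ.+-assoc N N n)

  ±1 : ℤ → Set
  ±1 a = a ≡ 1ℤ ⊎ a ≡ -1ℤ

  neg-±1 : ∀ {a} → ±1 a → ±1 (0ℤ ℤ.- a)
  neg-±1 (inj₁ refl) = inj₂ refl
  neg-±1 (inj₂ refl) = inj₁ refl

  product-±1 : ∀ m n → n < 2 ℕ.^ m → ±1 (coeff (thueMorseProduct m) n)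
  product-±1 zero    zero    _ = inj₁ refl
  product-±1 zero    (suc n) (s≤s ())
  product-±1 (suc m) n l with split (2 ℕ.^ m) n
  ... | inj₁ l′ = subst ±1
    (sym (factor-below (2 ℕ.^ m) {{2^≢0 m}} (thueMorseProduct m) n l′))
    (product-±1 m n l′)
  ... | inj₂ eq = subst ±1
    (trans (cong (ℤ._- coeff P r) (sym (zero-above m r)))
      (trans (sym (factor-above N {{2^≢0 m}} P r))
        (cong (coeff (thueMorseProduct (suc m))) eq)))
    (neg-±1 (product-±1 m r r<N))
    where
    N = 2 ℕ.^ m
    P = thueMorseProduct m
    r = n ∸ N
    r<N : r < N
    r<N = ℕ.+-cancelˡ-< N r N
      (subst₂ _<_ (sym eq) (cong (N ℕ.+_) (ℕ.+-identityʳ N)) l)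

  half : ∀ {a b} → ±1 a → ±1 b → + 2 ℤ.* + (∣ a ℤ.- b ∣ ℕ./ 2) ≡ + ∣ a ℤ.- b ∣
  half (inj₁ refl) (inj₁ refl) = refl
  half (inj₁ refl) (inj₂ refl) = refl
  half (inj₂ refl) (inj₁ refl) = refl
  half (inj₂ refl) (inj₂ refl) = refl

open Lemmas

thueMorse-stable : ∀ n m → n < m → coeff (thueMorseProduct m) n ≡ thueMorse n
thueMorse-stable n m l = trans
  (cong (λ z → coeff (thueMorseProduct z) n) (sym (ℕ.m∸n+n≡m l)))
  (stable-+ n (m ∸ suc n))

thueMorse-±1 : ∀ n → thueMorse n ≡ 1ℤ ⊎ thueMorse n ≡ -1ℤ
thueMorse-±1 n = product-±1 (suc n) n (n<m⇒n<2^m (ℕ.n≤1+n n))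

periodDoubling-exact : ∀ k →
  + 2 ℤ.* periodDoubling k ≡ + ∣ thueMorse k ℤ.- thueMorse (suc k) ∣
periodDoubling-exact k = half (thueMorse-±1 k) (thueMorse-±1 (suc k))

{-# OPTIONS --safe #-}

-- Modulo 2 and with q = 1/t, the matrix of H_k is t (I + q A_k), where A_k is the Hankel matrix
-- of 𝐝 with its diagonal of ones removed; in characteristic 2 its determinant is a permanent.
-- So the claim is that det (I + q A_k) = 1 in 𝔽₂[[q]].  Let y be the solution of
-- (I + q A_{k+1}) y = e_k.  If y_k = 1, then replacing the last column by the combination of
-- columns with coefficients y gives det (I + q A_{k+1}) = det (I + q A_k).  Since A_{k+1} is
-- alternating, y_k = ⟨y, (I + q A_{k+1}) y⟩ = ⟨y, y⟩ = (∑ y)², so it is enough that ∑ y = 1.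
-- This is a strong induction on k: by d_{2n} = 1 and d_{2n+1} = 1 + d_n, the folded vector
-- w_a = y_{2a} + y_{2a+1} solves the analogous system for ⌊k/2⌋, and ∑ w = ∑ y.
module Submission where

open import Defs
open import Algebra.Bundles using (CommutativeRing; CommutativeSemiring; RawRing)
import Algebra.Construct.Pointwise as Pointwise
import Algebra.Definitions.RawSemiring as RawSemiringDefs
import Algebra.Solver.Ring
open import Algebra.Solver.Ring.AlmostCommutativeRing
  using (fromCommutativeSemiring; _-Raw-AlmostCommutative⟶_)
open import Data.Bool.Base using (if_then_else_)
open import Data.Fin.Base using (Fin; zero; suc; toℕ; punchIn)
import Data.Fin.Properties as Fin
open import Data.Integer.Base as ℤ using (ℤ; +_; -[1+_]; 0ℤ; 1ℤ; -1ℤ; ∣_∣; _⊖_)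
import Data.Integer.Divisibility as ℤ
import Data.Integer.Properties as ℤ
open import Data.List.Base using (List; []; _∷_; _++_; [_]; applyUpTo; tabulate)
open import Data.List.Membership.Propositional using (_∈_)
open import Data.List.Membership.Propositional.Properties using (∈-∃++; ∈-applyUpTo⁺)
import Data.List.Properties as List
open import Data.List.Relation.Binary.Permutation.Propositional as ↭ using (_↭_)
open import Data.List.Relation.Binary.Permutation.Propositional.Properties using (shift)
open import Data.Maybe.Base using (Maybe; just; nothing)
open import Data.Nat.Base as ℕ using (ℕ; zero; suc; parity; _<_; _≤_; z≤n; s≤s)
import Data.Nat.Divisibility as ℕ
open import Data.Nat.Induction using (<-rec)
import Data.Nat.Properties as ℕ
open import Data.Parity.Base as ℙ using (Parity; 0ℙ; 1ℙ)
import Data.Parity.Properties as ℙ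
open import Data.Product.Base using (∃-syntax; _×_; _,_; proj₁; proj₂)
open import Data.Sum.Base using (_⊎_; inj₁; inj₂)
open import Function.Base using (_∘_)
open import Function.Bundles using (_⇔_; mk⇔)
open import Relation.Binary.PropositionalEquality as ≡ using (_≡_; _≢_)
open import Relation.Nullary.Decidable using (does; yes; no; dec-true; dec-false)
open import Relation.Nullary.Negation using (contradiction)

-- Formal power series

module PowerSeries {c ℓ} (K : CommutativeSemiring c ℓ) where
  private module K = CommutativeSemiring K
  open K using (Carrier; setoid)
  open import Algebra.Properties.CommutativeSemigroup K.+-commutativeSemigroup
    using (interchange; x∙yz≈y∙xz)
  open import Relation.Binary.Reasoning.Setoid setoid

  Series : Set c
  Series = ℕ → Carrier

  infix  4 _≈_
  infixl 6 _+_
  infixl 7 _*_ _·_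

  _≈_ : Series → Series → Set ℓ
  f ≈ g = ∀ n → f n K.≈ g n

  _+_ _*_ : Series → Series → Series
  (f + g) n = f n K.+ g n

  (f * g) zero    = f zero K.* g zero
  (f * g) (suc n) = f zero K.* g (suc n) K.+ ((f ∘ suc) * g) n

  _·_ : Carrier → Series → Series
  (a · f) n = a K.* f n

  constant : Carrier → Series
  constant a zero    = a
  constant a (suc n) = K.0#

  0# 1# q : Series
  0# _          = K.0#
  1#            = constant K.1#
  q zero        = K.0#
  q (suc n)     = 1# n

  *-cong : ∀ {f f′ g g′} → f ≈ f′ → g ≈ g′ → f * g ≈ f′ * g′
  *-cong p r zero    = K.*-cong (p 0) (r 0)
  *-cong p r (suc n) = K.+-cong (K.*-cong (p 0) (r (suc n))) (*-cong (p ∘ suc) r n)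

  *-zeroˡ : ∀ f → 0# * f ≈ 0#
  *-zeroˡ f zero    = K.zeroˡ _
  *-zeroˡ f (suc n) = K.trans (K.+-cong (K.zeroˡ _) (*-zeroˡ f n)) (K.+-identityˡ _)

  *-constant : ∀ a f → constant a * f ≈ a · f
  *-constant a f zero    = K.refl
  *-constant a f (suc n) = K.trans (K.+-congˡ (*-zeroˡ f n)) (K.+-identityʳ _)

  *-identityˡ : ∀ f → 1# * f ≈ f
  *-identityˡ f n = K.trans (*-constant K.1# f n) (K.*-identityˡ _)

  -- The mirror image of the defining recursion of `_*_`, which peels the first factor; the two
  -- recursions together give commutativity.
  *-suc : ∀ f g n → (f * g) (suc n) K.≈ f (suc n) K.* g zero K.+ (f * (g ∘ suc)) n
  *-suc f g zero    = K.+-comm _ _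
  *-suc f g (suc n) = begin
    f 0 K.* g (suc (suc n)) K.+ ((f ∘ suc) * g) (suc n)
      ≈⟨ K.+-congˡ (*-suc (f ∘ suc) g n) ⟩
    f 0 K.* g (suc (suc n)) K.+ (f (suc (suc n)) K.* g 0 K.+ ((f ∘ suc) * (g ∘ suc)) n)
      ≈⟨ x∙yz≈y∙xz _ _ _ ⟩
    f (suc (suc n)) K.* g 0 K.+ (f * (g ∘ suc)) (suc n) ∎

  *-comm : ∀ f g → f * g ≈ g * f
  *-comm f g zero    = K.*-comm _ _
  *-comm f g (suc n) = begin
    f 0 K.* g (suc n) K.+ ((f ∘ suc) * g) n ≈⟨ K.+-cong (K.*-comm _ _) (*-comm (f ∘ suc) g n) ⟩
    g (suc n) K.* f 0 K.+ (g * (f ∘ suc)) n ≈⟨ *-suc g f n ⟨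
    (g * f) (suc n)                         ∎

  *-distribʳ : ∀ f g h → (g + h) * f ≈ g * f + h * f
  *-distribʳ f g h zero    = K.distribʳ _ _ _
  *-distribʳ f g h (suc n) = K.trans
    (K.+-cong (K.distribʳ _ _ _) (*-distribʳ f (g ∘ suc) (h ∘ suc) n)) (interchange _ _ _ _)

  *-distribˡ : ∀ f g h → f * (g + h) ≈ f * g + f * h
  *-distribˡ f g h n = K.trans (*-comm f (g + h) n)
    (K.trans (*-distribʳ f g h n) (K.+-cong (*-comm g f n) (*-comm h f n)))

  ·-* : ∀ a f g → (a · f) * g ≈ a · (f * g)
  ·-* a f g zero    = K.*-assoc _ _ _
  ·-* a f g (suc n) = K.trans
    (K.+-cong (K.*-assoc _ _ _) (·-* a (f ∘ suc) g n)) (K.sym (K.distribˡ _ _ _))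

  *-assoc : ∀ f g h → (f * g) * h ≈ f * (g * h)
  *-assoc f g h zero    = K.*-assoc _ _ _
  *-assoc f g h (suc n) = begin
    -- The tail of `f * g` unfolds to `f 0 · (g ∘ suc) + (f ∘ suc) * g`, so `·-*` handles the first
    -- part and the induction hypothesis the second.
    f 0 K.* g 0 K.* h (suc n) K.+ ((f 0 · (g ∘ suc) + (f ∘ suc) * g) * h) n
      ≈⟨ K.+-cong (K.*-assoc _ _ _)
           (K.trans (*-distribʳ h (f 0 · (g ∘ suc)) ((f ∘ suc) * g) n)
                    (K.+-cong (·-* (f 0) (g ∘ suc) h n) (*-assoc (f ∘ suc) g h n))) ⟩
    f 0 K.* (g 0 K.* h (suc n)) K.+ (f 0 K.* ((g ∘ suc) * h) n K.+ ((f ∘ suc) * (g * h)) n)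
      ≈⟨ K.+-assoc _ _ _ ⟨
    f 0 K.* (g 0 K.* h (suc n)) K.+ f 0 K.* ((g ∘ suc) * h) n K.+ ((f ∘ suc) * (g * h)) n
      ≈⟨ K.+-congʳ (K.distribˡ _ _ _) ⟨
    f 0 K.* (g * h) (suc n) K.+ ((f ∘ suc) * (g * h)) n ∎

  commutativeSemiring : CommutativeSemiring c ℓ
  commutativeSemiring = record
    { Carrier = Series ; _≈_ = _≈_ ; _+_ = _+_ ; _*_ = _*_ ; 0# = 0# ; 1# = 1#
    ; isCommutativeSemiring = record
      { isSemiring = record
        { isSemiringWithoutAnnihilatingZero = record
          { +-isCommutativeMonoid = Pointwise.isCommutativeMonoid ℕ K.+-isCommutativeMonoid
          ; *-cong     = *-cong
          ; *-assoc    = *-assoc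
          ; *-identity = *-identityˡ , λ f n → K.trans (*-comm f 1# n) (*-identityˡ f n)
          ; distrib    = *-distribˡ , *-distribʳ
          }
        ; zero = *-zeroˡ , λ f n → K.trans (*-comm f 0# n) (*-zeroˡ f n)
        }
      ; *-comm = *-comm
      }
    }

  q*-zero : ∀ f → (q * f) 0 K.≈ K.0#
  q*-zero f = K.zeroˡ _

  q*-suc : ∀ f n → (q * f) (suc n) K.≈ f n
  q*-suc f n = K.trans (K.+-cong (K.zeroˡ _) (*-identityˡ f n)) (K.+-identityˡ _)

  -- The constant term 1 of `f` forces the lowest coefficient of `g` to vanish; then `f * (g ∘ suc)`
  -- is a shift of `f * g`, and the argument repeats.
  unit-regular : ∀ f → f 0 K.≈ K.1# → ∀ g → f * g ≈ 0# → g ≈ 0#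
  unit-regular f f₀ g h zero = begin
    g 0          ≈⟨ K.*-identityˡ _ ⟨
    K.1# K.* g 0 ≈⟨ K.*-congʳ f₀ ⟨
    f 0 K.* g 0  ≈⟨ h 0 ⟩
    K.0#         ∎
  unit-regular f f₀ g h (suc n) = unit-regular f f₀ (g ∘ suc) h′ n
    where
    h′ : f * (g ∘ suc) ≈ 0#
    h′ m = begin
      (f * (g ∘ suc)) m                           ≈⟨ K.+-identityˡ _ ⟨
      K.0# K.+ (f * (g ∘ suc)) m                    ≈⟨ K.+-congʳ (K.zeroʳ _) ⟨
      f (suc m) K.* K.0# K.+ (f * (g ∘ suc)) m      ≈⟨ K.+-congʳ (K.*-congˡ (unit-regular f f₀ g h 0)) ⟨
      f (suc m) K.* g 0 K.+ (f * (g ∘ suc)) m     ≈⟨ *-suc f g m ⟨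
      (f * g) (suc m)                             ≈⟨ h (suc m) ⟩
      K.0#                                        ∎

-- Linear algebra in characteristic 2

even-or-odd : ∀ k → ∃[ m ] (k ≡ 2 ℕ.* m ⊎ k ≡ suc (2 ℕ.* m))
even-or-odd zero    = 0 , inj₁ ≡.refl
even-or-odd (suc k) with even-or-odd k
... | m , inj₁ e = m , inj₂ (≡.cong suc e)
... | m , inj₂ e = suc m , inj₁ (≡.trans (≡.cong suc e) (≡.sym (ℕ.*-suc 2 m)))

module FiniteSums {c ℓ} (R : CommutativeSemiring c ℓ) where
  open CommutativeSemiring R
  open import Algebra.Properties.CommutativeSemigroup +-commutativeSemigroup using (interchange)
  open import Relation.Binary.Reasoning.Setoid setoid

  ∑ : ℕ → (ℕ → Carrier) → Carrier
  ∑ zero    f = 0#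
  ∑ (suc n) f = ∑ n f + f n

  ∑-cong : ∀ n {f g} → (∀ i → i < n → f i ≈ g i) → ∑ n f ≈ ∑ n g
  ∑-cong zero    h = refl
  ∑-cong (suc n) h = +-cong (∑-cong n (λ i l → h i (ℕ.m<n⇒m<1+n l))) (h n ℕ.≤-refl)

  ∑-zero : ∀ n {f} → (∀ i → i < n → f i ≈ 0#) → ∑ n f ≈ 0#
  ∑-zero zero    h = refl
  ∑-zero (suc n) h = trans
    (+-cong (∑-zero n (λ i l → h i (ℕ.m<n⇒m<1+n l))) (h n ℕ.≤-refl)) (+-identityˡ 0#)

  ∑-last : ∀ n {f} → (∀ i → i < n → f i ≈ 0#) → ∑ (suc n) f ≈ f n
  ∑-last n h = trans (+-congʳ (∑-zero n h)) (+-identityˡ _)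

  ∑-distrib-+ : ∀ n f g → ∑ n (λ i → f i + g i) ≈ ∑ n f + ∑ n g
  ∑-distrib-+ zero    f g = sym (+-identityˡ 0#)
  ∑-distrib-+ (suc n) f g = trans (+-congʳ (∑-distrib-+ n f g)) (interchange _ _ _ _)

  *-distribˡ-∑ : ∀ n a f → ∑ n (λ i → a * f i) ≈ a * ∑ n f
  *-distribˡ-∑ zero    a f = sym (zeroʳ a)
  *-distribˡ-∑ (suc n) a f = trans (+-congʳ (*-distribˡ-∑ n a f)) (sym (distribˡ a _ _))

  ∑-even-odd : ∀ m f → ∑ (2 ℕ.* m) f ≈ ∑ m (λ a → f (2 ℕ.* a)) + ∑ m (λ a → f (suc (2 ℕ.* a)))
  ∑-even-odd zero    f = sym (+-identityˡ 0#)
  ∑-even-odd (suc m) f rewrite ℕ.+-suc m (m ℕ.+ 0) =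
    trans (+-congʳ (+-congʳ (∑-even-odd m f)))
      (trans (+-assoc _ _ _) (interchange _ _ _ _))

HasCharacteristic2 : ∀ {c ℓ} → CommutativeSemiring c ℓ → Set ℓ
HasCharacteristic2 R = 1# + 1# ≈ 0#
  where open CommutativeSemiring R

module Characteristic2 {c ℓ} (R : CommutativeSemiring c ℓ) (1+1≈0 : HasCharacteristic2 R) where

  open CommutativeSemiring R
  open FiniteSums R
  open import Relation.Binary.Reasoning.Setoid setoid

  ⟦_⟧ : Parity → Carrier
  ⟦ 0ℙ ⟧ = 0#
  ⟦ 1ℙ ⟧ = 1#

  private
    -- Taking coefficients in ℤ/2 lets the solver use x + x ≈ 0.
    morphism : CommutativeRing.rawRing ℙ.+-*-commutativeRing
               -Raw-AlmostCommutative⟶ fromCommutativeSemiring R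
    morphism = record
      { ⟦_⟧    = ⟦_⟧
      ; +-homo = λ { 0ℙ _ → sym (+-identityˡ _) ; 1ℙ 0ℙ → sym (+-identityʳ _) ; 1ℙ 1ℙ → sym 1+1≈0 }
      ; *-homo = λ { 0ℙ _ → sym (zeroˡ _) ; 1ℙ _ → sym (*-identityˡ _) }
      ; -‿homo = λ _ → refl
      ; 0-homo = refl
      ; 1-homo = refl
      }

    _≟_ : ∀ a b → Maybe (⟦ a ⟧ ≈ ⟦ b ⟧)
    0ℙ ≟ 0ℙ = just refl
    1ℙ ≟ 1ℙ = just refl
    _  ≟ _  = nothing

  open Algebra.Solver.Ring _ _ morphism _≟_
    public using (solve; con; _:+_; _:*_; _:=_)

  x+x≈0 : ∀ x → x + x ≈ 0#
  x+x≈0 = solve 1 (λ x → x :+ x := con 0ℙ) refl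

  -- Off-diagonal terms come in equal pairs and cancel. The unit diagonal leaves the sum of the
  -- squares, which in characteristic 2 is the square of the sum.
  ∑-quadratic : ∀ (b : ℕ → ℕ → Carrier) → (∀ i j → b i j ≈ b j i) → (∀ i → b i i ≈ 1#) →
    ∀ n u → ∑ n (λ i → u i * ∑ n (λ j → b i j * u j)) ≈ ∑ n u * ∑ n u
  ∑-quadratic b b-sym b-diag zero    u = sym (zeroˡ 0#)
  ∑-quadratic b b-sym b-diag (suc n) u = begin
    ∑ n (λ i → u i * (∑ n (λ j → b i j * u j) + b i n * u n)) + u n * (C + b n n * u n)
      ≈⟨ +-cong
           (trans (∑-cong n (λ i _ → trans (distribˡ _ _ _) (+-congˡ (cross i))))
             (trans (∑-distrib-+ n _ _)
               (+-cong (∑-quadratic b b-sym b-diag n u) (*-distribˡ-∑ n (u n) _))))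
           (*-congˡ (+-congˡ (*-congʳ (b-diag n)))) ⟩
    ∑ n u * ∑ n u + u n * C + u n * (C + 1# * u n)
      ≈⟨ solve 3 (λ s v c → s :* s :+ v :* c :+ v :* (c :+ con 1ℙ :* v) := (s :+ v) :* (s :+ v))
           refl (∑ n u) (u n) C ⟩
    (∑ n u + u n) * (∑ n u + u n) ∎
    where
    C : Carrier
    C = ∑ n (λ j → b n j * u j)
    cross : ∀ i → u i * (b i n * u n) ≈ u n * (b n i * u i)
    cross i = trans (*-congˡ (*-congʳ (b-sym i n)))
      (solve 3 (λ x y z → x :* (y :* z) := z :* (y :* x)) refl (u i) (b n i) (u n))

  ∑-square : ∀ n u → ∑ n (λ i → u i * u i) ≈ ∑ n u * ∑ n u
  ∑-square zero    u = sym (zeroˡ 0#)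
  ∑-square (suc n) u = trans (+-congʳ (∑-square n u))
    (solve 2 (λ s v → s :* s :+ v :* v := (s :+ v) :* (s :+ v)) refl (∑ n u) (u n))

  -- The linear system of the period-doubling Hankel matrix

  module PeriodDoublingResolvent
    (d : ℕ → Carrier)
    (d-even : ∀ n → d (2 ℕ.* n) ≈ 1#)
    (d-odd  : ∀ n → d (suc (2 ℕ.* n)) ≈ 1# + d n)
    (q : Carrier)
    (1+q*-regular : ∀ f g → (1# + q * f) * g ≈ 0# → g ≈ 0#)
    where

    -- Row i of the matrix I + q A applied to y, where A is the n × n Hankel matrix of d
    -- with its (unit) diagonal removed.
    row : ℕ → (ℕ → Carrier) → ℕ → Carrier
    row n y i = y i + q * (y i + ∑ n (λ j → d (i ℕ.+ j) * y j))

    d-2* : ∀ n → d (n ℕ.+ n) ≈ 1#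
    d-2* n = trans (reflexive (≡.cong (λ z → d (n ℕ.+ z)) (≡.sym (ℕ.+-identityʳ n)))) (d-even n)

    d-diag : ∀ n u → ∑ n (λ i → u i * ∑ n (λ j → d (i ℕ.+ j) * u j)) ≈ ∑ n u * ∑ n u
    d-diag = ∑-quadratic (λ i j → d (i ℕ.+ j)) (λ i j → reflexive (≡.cong d (ℕ.+-comm i j))) d-2*

    -- `d-diag` collapses the double sum to a square. With `s` zero and `v = u` this covers `row`
    -- itself; a nonzero `s` and a separate `v` cover the rows in `Halving`.
    ∑-pairing : ∀ n (u v : ℕ → Carrier) s →
      ∑ n (λ a → u a * (v a + q * (v a + (s + ∑ n (λ b → d (a ℕ.+ b) * u b)))))
      ≈ ∑ n (λ a → u a * v a) + q * (∑ n (λ a → u a * v a) + (s * ∑ n u + ∑ n u * ∑ n u))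
    ∑-pairing n u v s = begin
      ∑ n (λ a → u a * (v a + q * (v a + (s + Du a))))
        ≈⟨ ∑-cong n (λ a _ → solve 5
             (λ x y q s z → x :* (y :+ q :* (y :+ (s :+ z)))
                := x :* y :+ q :* (x :* y :+ (s :* x :+ x :* z))) refl (u a) (v a) q s (Du a)) ⟩
      ∑ n (λ a → u a * v a + q * (u a * v a + (s * u a + u a * Du a)))
        ≈⟨ trans (∑-distrib-+ n _ _) (+-congˡ (trans (*-distribˡ-∑ n q _) (*-congˡ
             (trans (∑-distrib-+ n _ _) (+-congˡ (trans (∑-distrib-+ n _ _)
               (+-cong (*-distribˡ-∑ n s u) (d-diag n u)))))))) ⟩
      ∑ n (λ a → u a * v a) + q * (∑ n (λ a → u a * v a) + (s * ∑ n u + ∑ n u * ∑ n u)) ∎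
      where
      Du : ℕ → Carrier
      Du a = ∑ n (λ b → d (a ℕ.+ b) * u b)

    -- The other rows vanish, so the left side is the whole pairing of `u` with `(I + q A) u`. As
    -- `A` is alternating, only the sum of the squares of `u` survives.
    row-pairing : ∀ n u → (∀ i → i < n → row (suc n) u i ≈ 0#) →
      u n * row (suc n) u n ≈ ∑ (suc n) u * ∑ (suc n) u
    row-pairing n u h = begin
      u n * row (suc n) u n
        ≈⟨ ∑-last n (λ i l → trans (*-congˡ (h i l)) (zeroʳ _)) ⟨
      ∑ (suc n) (λ a → u a * row (suc n) u a)
        ≈⟨ ∑-cong (suc n) (λ a _ → *-congˡ (+-congˡ (*-congˡ (+-congˡ (+-identityˡ _))))) ⟨
      ∑ (suc n) (λ a → u a * (u a + q * (u a + (0# + ∑ (suc n) (λ b → d (a ℕ.+ b) * u b)))))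
        ≈⟨ ∑-pairing (suc n) u u 0# ⟩
      N + q * (N + (0# * S + S * S))
        ≈⟨ +-cong (∑-square (suc n) u) (*-congˡ (+-congʳ (∑-square (suc n) u))) ⟩
      S * S + q * (S * S + (0# * S + S * S))
        ≈⟨ solve 2 (λ s q → s :* s :+ q :* (s :* s :+ (con 0ℙ :* s :+ s :* s)) := s :* s) refl S q ⟩
      S * S ∎
      where
      N S : Carrier
      N = ∑ (suc n) (λ a → u a * u a)
      S = ∑ (suc n) u

    -- Indices are split by parity. Where row and column parities agree, `d` is 1 and contributes
    -- only `∑x` or `∑z`; where they differ, `d-odd` gives 1 plus an entry of the half-size matrix.
    module Halving (m : ℕ) (y : ℕ → Carrier) where
      x z w : ℕ → Carrier
      x a = y (2 ℕ.* a)
      z a = y (suc (2 ℕ.* a))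
      w a = x a + z a

      ∑x ∑z : Carrier
      ∑x = ∑ m x
      ∑z = ∑ m z

      D : (ℕ → Carrier) → ℕ → Carrier
      D u a = ∑ m (λ b → d (a ℕ.+ b) * u b)

      ∑y≈∑w : ∑ (2 ℕ.* m) y ≈ ∑ m w
      ∑y≈∑w = trans (∑-even-odd m y) (sym (∑-distrib-+ m x z))

      private
        even : ∀ {i a} u → i ≡ 2 ℕ.* a → d i * u ≈ u
        even {a = a} u ≡.refl = trans (*-congʳ (d-even a)) (*-identityˡ u)

        odd : ∀ {i} a u → i ≡ suc (2 ℕ.* a) → d i * u ≈ u + d a * u
        odd a u ≡.refl = trans (*-congʳ (d-odd a)) (trans (distribʳ _ _ _) (+-congʳ (*-identityˡ u)))

      row-even : ∀ a → row (2 ℕ.* m) y (2 ℕ.* a) ≈ x a + q * (x a + ((∑x + ∑z) + D z a))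
      row-even a = +-congˡ (*-congˡ (+-congˡ (begin
        ∑ (2 ℕ.* m) (λ j → d (2 ℕ.* a ℕ.+ j) * y j)
          ≈⟨ ∑-even-odd m _ ⟩
        ∑ m (λ b → d (2 ℕ.* a ℕ.+ 2 ℕ.* b) * x b) + ∑ m (λ b → d (2 ℕ.* a ℕ.+ suc (2 ℕ.* b)) * z b)
          ≈⟨ +-cong
               (∑-cong m (λ b _ → even {a = a ℕ.+ b} (x b) (≡.sym (ℕ.*-distribˡ-+ 2 a b))))
               (trans (∑-cong m (λ b _ → odd (a ℕ.+ b) (z b)
                  (≡.trans (ℕ.+-suc _ _) (≡.cong suc (≡.sym (ℕ.*-distribˡ-+ 2 a b))))))
                 (∑-distrib-+ m _ _)) ⟩
        ∑x + (∑z + D z a) ≈⟨ +-assoc _ _ _ ⟨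
        (∑x + ∑z) + D z a ∎)))

      row-odd : ∀ a → row (2 ℕ.* m) y (suc (2 ℕ.* a)) ≈ z a + q * (z a + ((∑x + ∑z) + D x a))
      row-odd a = +-congˡ (*-congˡ (+-congˡ (begin
        ∑ (2 ℕ.* m) (λ j → d (suc (2 ℕ.* a) ℕ.+ j) * y j)
          ≈⟨ ∑-even-odd m _ ⟩
        ∑ m (λ b → d (suc (2 ℕ.* a) ℕ.+ 2 ℕ.* b) * x b)
          + ∑ m (λ b → d (suc (2 ℕ.* a) ℕ.+ suc (2 ℕ.* b)) * z b)
          ≈⟨ +-cong
               (trans (∑-cong m (λ b _ → odd (a ℕ.+ b) (x b)
                  (≡.cong suc (≡.sym (ℕ.*-distribˡ-+ 2 a b)))))
                 (∑-distrib-+ m _ _))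
               (∑-cong m (λ b _ → even {a = suc (a ℕ.+ b)} (z b) (≡.trans
                  (≡.cong suc (≡.trans (ℕ.+-suc _ _) (≡.cong suc (≡.sym (ℕ.*-distribˡ-+ 2 a b)))))
                  (≡.sym (ℕ.*-suc 2 (a ℕ.+ b)))))) ⟩
        (∑x + D x a) + ∑z ≈⟨ solve 3 (λ x d z → (x :+ d) :+ z := (x :+ z) :+ d) refl ∑x (D x a) ∑z ⟩
        (∑x + ∑z) + D x a ∎)))

      -- The term `∑x + ∑z` occurs in both rows of the pair and cancels; `D x a` and `D z a` add up
      -- to `D w a`.
      row-w : ∀ a → row m w a ≈ row (2 ℕ.* m) y (2 ℕ.* a) + row (2 ℕ.* m) y (suc (2 ℕ.* a))
      row-w a = begin
        w a + q * (w a + D w a)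
          ≈⟨ +-congˡ (*-congˡ (+-congˡ (trans (∑-cong m (λ b _ → distribˡ _ _ _)) (∑-distrib-+ m _ _)))) ⟩
        (x a + z a) + q * ((x a + z a) + (D x a + D z a))
          ≈⟨ solve 6 (λ x z q s u v → (x :+ z) :+ q :* ((x :+ z) :+ (u :+ v)) :=
               (x :+ q :* (x :+ (s :+ v))) :+ (z :+ q :* (z :+ (s :+ u))))
               refl (x a) (z a) q (∑x + ∑z) (D x a) (D z a) ⟩
        (x a + q * (x a + ((∑x + ∑z) + D z a))) + (z a + q * (z a + ((∑x + ∑z) + D x a)))
          ≈⟨ +-cong (row-even a) (row-odd a) ⟨
        row (2 ℕ.* m) y (2 ℕ.* a) + row (2 ℕ.* m) y (suc (2 ℕ.* a)) ∎

    -- The last row is `1# + q * c` rather than `1#` because the even case folds to a vector whose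
    -- last row is known only up to a multiple of `q`; this shape also keeps the value regular.
    -- Vanishing beyond `k` allows padding to even length.
    SumIsLastEntry : ℕ → Set _
    SumIsLastEntry k = ∀ c y → (∀ i → k < i → y i ≈ 0#) → (∀ i → i < k → row (suc k) y i ≈ 0#) →
      row (suc k) y k ≈ 1# + q * c → ∑ (suc k) y ≈ 1# + q * c

    sum≈last-zero : SumIsLastEntry 0
    sum≈last-zero c y _ _ h = begin
      0# + y 0
        ≈⟨ solve 2 (λ y q → con 0ℙ :+ y := y :+ q :* (y :+ (con 0ℙ :+ con 1ℙ :* y))) refl (y 0) q ⟩
      y 0 + q * (y 0 + (0# + 1# * y 0))
        ≈⟨ +-congˡ (*-congˡ (+-congˡ (+-congˡ (*-congʳ (d-even 0))))) ⟨
      row 1 y 0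
        ≈⟨ h ⟩
      1# + q * c ∎

    -- The length `2 + 2m` is even, so the entries fold without padding, and the last pair of rows
    -- adds up to `0# + (1# + q * c)`.
    sum≈last-odd : ∀ m → SumIsLastEntry m → SumIsLastEntry (suc (2 ℕ.* m))
    sum≈last-odd m IH c y y≈0 row≈0 row-k = begin
      ∑ (2 ℕ.+ 2 ℕ.* m) y ≡⟨ ≡.cong (λ n → ∑ n y) (ℕ.*-suc 2 m) ⟨
      ∑ (2 ℕ.* suc m) y   ≈⟨ ∑y≈∑w ⟩
      ∑ (suc m) w         ≈⟨ IH c w
        (λ i l → trans (+-cong (y≈0 (2 ℕ.* i) (up l)) (y≈0 _ (ℕ.m<n⇒m<1+n (up l)))) (+-identityˡ 0#))
        (λ i l → trans (rows i) (trans
          (+-cong (row≈0 (2 ℕ.* i) (ℕ.m<n⇒m<1+n (ℕ.*-monoʳ-< 2 l)))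
                  (row≈0 (suc (2 ℕ.* i)) (s≤s (ℕ.*-monoʳ-< 2 l)))) (+-identityˡ 0#)))
        (trans (rows m) (trans (+-cong (row≈0 (2 ℕ.* m) ℕ.≤-refl) row-k) (+-identityˡ _))) ⟩
      1# + q * c          ∎
      where
      open Halving (suc m) y
      up : ∀ {i} → m < i → suc (2 ℕ.* m) < 2 ℕ.* i
      up {i} l = ≡.subst (ℕ._≤ 2 ℕ.* i) (ℕ.*-suc 2 m) (ℕ.*-monoʳ-≤ 2 l)
      rows : ∀ a → row (suc m) w a
        ≈ row (2 ℕ.+ 2 ℕ.* m) y (2 ℕ.* a) + row (2 ℕ.+ 2 ℕ.* m) y (suc (2 ℕ.* a))
      rows a = trans (row-w a) (reflexive (≡.cong
        (λ n → row n y (2 ℕ.* a) + row n y (suc (2 ℕ.* a))) (ℕ.*-suc 2 m)))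

    -- Let α be the next entry of (I + q A) y, below those that are prescribed.  Pairing the
    -- equations gives α w_m = 0 for the last entry w_m of w, and w_m S = S² for S = ∑ w.  The
    -- induction hypothesis for w is S = 1 + q c + α, so that S is regular and α = 0.
    sum≈last-even : ∀ m → SumIsLastEntry m → SumIsLastEntry (2 ℕ.* m)
    sum≈last-even m IH c y y≈0 row≈0 row-k = begin
      ∑ (suc (2 ℕ.* m)) y ≈⟨ +-identityʳ _ ⟨
      ∑ (suc (2 ℕ.* m)) y + 0# ≈⟨ +-congˡ y-next ⟨
      ∑ (2 ℕ.+ 2 ℕ.* m) y ≡⟨ ≡.cong (λ n → ∑ n y) (ℕ.*-suc 2 m) ⟨
      ∑ (2 ℕ.* suc m) y   ≈⟨ ∑y≈∑w ⟩
      S                   ≈⟨ S≈ ⟩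
      1# + q * (c + c′)   ≈⟨ +-congˡ (distribˡ _ _ _) ⟩
      1# + (q * c + q * c′) ≈⟨ +-congˡ (+-congˡ (trans (sym α≈) α≈0)) ⟩
      1# + (q * c + 0#)   ≈⟨ +-congˡ (+-identityʳ _) ⟩
      1# + q * c          ∎
      where
      open Halving (suc m) y
      S : Carrier
      S = ∑ (suc m) w

      -- The odd length is padded by this zero entry, so the last entry of `w` is `x m`.
      y-next : y (suc (2 ℕ.* m)) ≈ 0#
      y-next = y≈0 _ ℕ.≤-refl

      rows-y : ∀ i → row (2 ℕ.* suc m) y i ≈ row (suc (2 ℕ.* m)) y i
      rows-y i = trans (reflexive (≡.cong (λ n → row n y i) (ℕ.*-suc 2 m)))
        (+-congˡ (*-congˡ (+-congˡ (trans (+-congˡ (trans (*-congˡ y-next) (zeroʳ _))) (+-identityʳ _)))))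

      even≈0 : ∀ i → i < m → row (2 ℕ.* suc m) y (2 ℕ.* i) ≈ 0#
      even≈0 i l = trans (rows-y _) (row≈0 _ (ℕ.*-monoʳ-< 2 l))

      odd≈0 : ∀ i → i < m → row (2 ℕ.* suc m) y (suc (2 ℕ.* i)) ≈ 0#
      odd≈0 i l = trans (rows-y _) (row≈0 _
        (≡.subst (ℕ._≤ 2 ℕ.* m) (ℕ.*-suc 2 i) (ℕ.*-monoʳ-≤ 2 l)))

      α c′ : Carrier
      α  = row (2 ℕ.* suc m) y (suc (2 ℕ.* m))
      c′ = (∑x + ∑z) + D x m

      α≈ : α ≈ q * c′
      α≈ = trans (row-odd m) (trans (+-cong y-next (*-congˡ (trans (+-congʳ y-next) (+-identityˡ _)))) (+-identityˡ _))

      -- Pair `z` with the even rows and `x` with the odd rows. Both pairings equal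
      -- `P + q * (P + ∑x * ∑z)`, so their sum is zero; on the other hand all its terms vanish
      -- except `x m * α`.
      αx≈0 : x m * α ≈ 0#
      αx≈0 = begin
        x m * α ≈⟨ +-identityˡ _ ⟨
        0# + x m * α
          ≈⟨ +-cong (trans (*-congʳ y-next) (zeroˡ _)) (*-congˡ (sym (row-odd m))) ⟨
        z m * (x m + q * (x m + ((∑x + ∑z) + D z m))) + x m * (z m + q * (z m + ((∑x + ∑z) + D x m)))
          ≈⟨ +-cong
              (∑-last m (λ i l → trans (*-congˡ (trans (sym (row-even i)) (even≈0 i l))) (zeroʳ _)))
              (∑-last m (λ i l → trans (*-congˡ (trans (sym (row-odd i)) (odd≈0 i l))) (zeroʳ _))) ⟨
        ∑ (suc m) (λ a → z a * (x a + q * (x a + ((∑x + ∑z) + D z a))))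
          + ∑ (suc m) (λ a → x a * (z a + q * (z a + ((∑x + ∑z) + D x a))))
          ≈⟨ +-cong (∑-pairing (suc m) z x (∑x + ∑z)) (∑-pairing (suc m) x z (∑x + ∑z)) ⟩
        (∑ (suc m) (λ a → z a * x a) + q * (∑ (suc m) (λ a → z a * x a) + ((∑x + ∑z) * ∑z + ∑z * ∑z)))
          + (P + q * (P + ((∑x + ∑z) * ∑x + ∑x * ∑x)))
          ≈⟨ +-congʳ (+-cong zx≈P (*-congˡ (+-congʳ zx≈P))) ⟩
        (P + q * (P + ((∑x + ∑z) * ∑z + ∑z * ∑z))) + (P + q * (P + ((∑x + ∑z) * ∑x + ∑x * ∑x)))
          ≈⟨ solve 4 (λ p q x z → (p :+ q :* (p :+ ((x :+ z) :* z :+ z :* z)))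
               :+ (p :+ q :* (p :+ ((x :+ z) :* x :+ x :* x))) := con 0ℙ) refl P q ∑x ∑z ⟩
        0# ∎
        where
        P : Carrier
        P = ∑ (suc m) (λ a → x a * z a)
        zx≈P : ∑ (suc m) (λ a → z a * x a) ≈ P
        zx≈P = ∑-cong (suc m) (λ a _ → *-comm _ _)

      row-w≈0 : ∀ i → i < m → row (suc m) w i ≈ 0#
      row-w≈0 i l = trans (row-w i) (trans (+-cong (even≈0 i l) (odd≈0 i l)) (+-identityˡ 0#))

      row-w-m : row (suc m) w m ≈ 1# + q * (c + c′)
      row-w-m = trans (row-w m) (trans (+-cong (trans (rows-y _) row-k) α≈)
        (trans (+-assoc _ _ _) (+-congˡ (sym (distribˡ _ _ _)))))

      up : ∀ {i} → m < i → 2 ℕ.* m < 2 ℕ.* i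
      up l = ℕ.*-monoʳ-< 2 l

      S≈ : S ≈ 1# + q * (c + c′)
      S≈ = IH (c + c′) w
        (λ i l → trans (+-cong (y≈0 (2 ℕ.* i) (up l)) (y≈0 _ (ℕ.m<n⇒m<1+n (up l)))) (+-identityˡ 0#))
        row-w≈0 row-w-m

      xS≈S² : x m * S ≈ S * S
      xS≈S² = begin
        x m * S                 ≈⟨ *-cong (sym (trans (+-congˡ y-next) (+-identityʳ _))) (trans S≈ (sym row-w-m)) ⟩
        w m * row (suc m) w m   ≈⟨ row-pairing m w row-w≈0 ⟩
        S * S                   ∎

      -- `S * S` annihilates `α`; each use of regularity removes one factor `S`.
      α≈0 : α ≈ 0#
      α≈0 = 1+q*-regular (c + c′) α (1+q*-regular (c + c′) _ (begin
        (1# + q * (c + c′)) * ((1# + q * (c + c′)) * α) ≈⟨ *-cong S≈ (*-congʳ S≈) ⟨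
        S * (S * α)     ≈⟨ *-assoc _ _ _ ⟨
        S * S * α       ≈⟨ *-congʳ xS≈S² ⟨
        x m * S * α     ≈⟨ solve 3 (λ x s a → x :* s :* a := s :* (x :* a)) refl (x m) S α ⟩
        S * (x m * α)   ≈⟨ *-congˡ αx≈0 ⟩
        S * 0#          ≈⟨ zeroʳ S ⟩
        0#              ∎))

    sum≈last : ∀ k → SumIsLastEntry k
    sum≈last = <-rec SumIsLastEntry step
      where
      step : ∀ k → (∀ {m} → m < k → SumIsLastEntry m) → SumIsLastEntry k
      step k IH with even-or-odd k
      -- Zero is its own half, so here halving would not descend.
      ... | zero  , inj₁ ≡.refl = sum≈last-zero
      ... | suc m , inj₁ ≡.refl = sum≈last-even (suc m) (IH {suc m} (ℕ.m<m+n (suc m) (s≤s z≤n)))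
      ... | m     , inj₂ ≡.refl = sum≈last-odd m (IH {m} (s≤s (ℕ.m≤m+n m _)))

-- Permanents of lists of columns

module Permanent {c ℓ} (R : CommutativeSemiring c ℓ) where
  open CommutativeSemiring R
  open FiniteSums R
  open import Algebra.Properties.CommutativeSemigroup +-commutativeSemigroup
    using (interchange; x∙yz≈y∙xz)
  open import Algebra.Properties.CommutativeSemigroup *-commutativeSemigroup
    using () renaming (x∙yz≈y∙xz to x*yz≈y*xz)
  open import Relation.Binary.Reasoning.Setoid setoid

  -- Laplace expansion without signs: each column is chosen in turn, and `F` also receives the
  -- remaining ones in their order, that is, the columns of the minor.
  pickSum : ∀ {a} {A : Set a} → (A → List A → Carrier) → List A → Carrier
  pickSum F []       = 0#
  pickSum F (x ∷ xs) = F x xs + pickSum (λ y ys → F y (x ∷ ys)) xs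

  module _ {a} {A : Set a} where
    pickSum-cong : ∀ {F G : A → List A → Carrier} → (∀ x xs → F x xs ≈ G x xs) →
      ∀ xs → pickSum F xs ≈ pickSum G xs
    pickSum-cong h []       = refl
    pickSum-cong h (x ∷ xs) = +-cong (h x xs) (pickSum-cong (λ y ys → h y (x ∷ ys)) xs)

    pickSum-zero : ∀ {F : A → List A → Carrier} → (∀ x xs → F x xs ≈ 0#) →
      ∀ xs → pickSum F xs ≈ 0#
    pickSum-zero h []       = refl
    pickSum-zero h (x ∷ xs) =
      trans (+-cong (h x xs) (pickSum-zero (λ y ys → h y (x ∷ ys)) xs)) (+-identityˡ 0#)

    pickSum-+ : ∀ (F G : A → List A → Carrier) xs →
      pickSum (λ y ys → F y ys + G y ys) xs ≈ pickSum F xs + pickSum G xs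
    pickSum-+ F G []       = sym (+-identityˡ 0#)
    pickSum-+ F G (x ∷ xs) =
      trans (+-congˡ (pickSum-+ (λ y ys → F y (x ∷ ys)) (λ y ys → G y (x ∷ ys)) xs)) (interchange _ _ _ _)

    pickSum-*ˡ : ∀ b (F : A → List A → Carrier) xs →
      pickSum (λ y ys → b * F y ys) xs ≈ b * pickSum F xs
    pickSum-*ˡ b F []       = sym (zeroʳ b)
    pickSum-*ˡ b F (x ∷ xs) =
      trans (+-congˡ (pickSum-*ˡ b (λ y ys → F y (x ∷ ys)) xs)) (sym (distribˡ b _ _))

    pickSum-↭ : ∀ {F : A → List A → Carrier} → (∀ x {xs ys} → xs ↭ ys → F x xs ≈ F x ys) →
      ∀ {xs ys} → xs ↭ ys → pickSum F xs ≈ pickSum F ys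
    pickSum-↭ h ↭.refl         = refl
    pickSum-↭ h (↭.prep x p)   = +-cong (h x p) (pickSum-↭ (λ y p′ → h y (↭.prep x p′)) p)
    -- The swap exchanges the first two summands. In the others, the recursive call changes the tail
    -- only, and the prefix is swapped afterwards by `pickSum-cong`.
    pickSum-↭ h (↭.swap {ys = ys} x y p) = trans (x∙yz≈y∙xz _ _ _)
      (+-cong (h y (↭.prep x p)) (+-cong (h x (↭.prep y p))
        (trans (pickSum-↭ (λ z p′ → h z (↭.prep x (↭.prep y p′))) p)
               (pickSum-cong (λ z zs → h z (↭.swap x y (↭.refl {xs = zs}))) ys))))
    pickSum-↭ h (↭.trans p p′) = trans (pickSum-↭ h p) (pickSum-↭ h p′)

  Column : Set c
  Column = ℕ → Carrier

  perm₀ : List Column → Carrier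
  perm₀ []      = 1#
  perm₀ (_ ∷ _) = 0#

  -- The permanent of rows r, …, r + n ∸ 1 of the given columns; it is 0 unless there are
  -- exactly n columns.
  perm : ℕ → ℕ → List Column → Carrier
  perm zero    r cs = perm₀ cs
  perm (suc n) r cs = pickSum (λ u us → u r * perm n (suc r) us) cs

  perm₀-↭ : ∀ {cs ds} → cs ↭ ds → perm₀ cs ≈ perm₀ ds
  perm₀-↭ ↭.refl         = refl
  perm₀-↭ (↭.prep _ _)   = refl
  perm₀-↭ (↭.swap _ _ _) = refl
  perm₀-↭ (↭.trans p p′) = trans (perm₀-↭ p) (perm₀-↭ p′)

  perm-↭ : ∀ n r {cs ds} → cs ↭ ds → perm n r cs ≈ perm n r ds
  perm-↭ zero    r p = perm₀-↭ p
  perm-↭ (suc n) r p = pickSum-↭ (λ u p′ → *-congˡ (perm-↭ n (suc r) p′)) p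

  perm-zero : ∀ n r cs → perm n r ((λ _ → 0#) ∷ cs) ≈ 0#
  perm-zero zero    r cs = refl
  perm-zero (suc n) r cs = trans
    (+-cong (zeroˡ _)
      (pickSum-zero (λ u us → trans (*-congˡ (perm-zero n (suc r) us)) (zeroʳ _)) cs))
    (+-identityˡ 0#)

  -- Addition and scaling are treated together because `u i + b * v i` is the shape of one step of
  -- `∑` in `perm-∑`.
  perm-+* : ∀ n r u b v cs →
    perm n r ((λ i → u i + b * v i) ∷ cs) ≈ perm n r (u ∷ cs) + b * perm n r (v ∷ cs)
  perm-+* zero    r u b v cs = sym (trans (+-identityˡ _) (zeroʳ b))
  perm-+* (suc n) r u b v cs = begin
    (u r + b * v r) * P + pickSum (λ x xs → x r * perm n (suc r) ((λ i → u i + b * v i) ∷ xs)) cs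
      ≈⟨ +-cong (trans (distribʳ _ _ _) (+-congˡ (*-assoc _ _ _)))
          (trans (pickSum-cong (λ x xs → trans (*-congˡ (perm-+* n (suc r) u b v xs))
                    (trans (distribˡ _ _ _) (+-congˡ (x*yz≈y*xz _ _ _)))) cs)
                 (trans (pickSum-+ _ _ cs) (+-congˡ (pickSum-*ˡ b _ cs)))) ⟩
    (u r * P + b * (v r * P)) + (U + b * V) ≈⟨ interchange _ _ _ _ ⟩
    (u r * P + U) + (b * (v r * P) + b * V) ≈⟨ +-congˡ (distribˡ b _ _) ⟨
    (u r * P + U) + b * (v r * P + V)       ∎
    where
    P U V : Carrier
    P = perm n (suc r) cs
    U = pickSum (λ x xs → x r * perm n (suc r) (u ∷ xs)) cs
    V = pickSum (λ x xs → x r * perm n (suc r) (v ∷ xs)) cs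

  perm-∑ : ∀ n r k (b : ℕ → Carrier) (f : ℕ → Column) cs →
    perm n r ((λ i → ∑ k (λ j → b j * f j i)) ∷ cs) ≈ ∑ k (λ j → b j * perm n r (f j ∷ cs))
  perm-∑ n r zero    b f cs = perm-zero n r cs
  perm-∑ n r (suc k) b f cs = trans
    (perm-+* n r (λ i → ∑ k (λ j → b j * f j i)) (b k) (f k) cs)
    (+-congʳ (perm-∑ n r k b f cs))

  -- The column `u` is the last unit vector, so choosing it contributes nothing before the last row.
  -- There it must be chosen: any other choice leaves `u` over, and `perm₀` is zero.
  perm-last-row : ∀ n r u cs → (∀ i → i < n → u (i ℕ.+ r) ≈ 0#) → u (n ℕ.+ r) ≈ 1# →
    perm (suc n) r (u ∷ cs) ≈ perm n r cs
  perm-last-row zero    r u cs h e = begin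
    u r * perm₀ cs + pickSum (λ x xs → x r * 0#) cs
      ≈⟨ +-cong (trans (*-congʳ e) (*-identityˡ _)) (pickSum-zero (λ x xs → zeroʳ _) cs) ⟩
    perm₀ cs + 0# ≈⟨ +-identityʳ _ ⟩
    perm₀ cs      ∎
  perm-last-row (suc n) r u cs h e = trans
    (+-cong (trans (*-congʳ (h 0 (s≤s z≤n))) (zeroˡ _))
      (pickSum-cong (λ x xs → *-congˡ (perm-last-row n (suc r) u xs h′ e′)) cs))
    (+-identityˡ _)
    where
    h′ : ∀ i → i < n → u (i ℕ.+ suc r) ≈ 0#
    h′ i l = trans (reflexive (≡.cong u (ℕ.+-suc i r))) (h (suc i) (s≤s l))
    e′ : u (n ℕ.+ suc r) ≈ 1#
    e′ = trans (reflexive (≡.cong u (ℕ.+-suc n r))) e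

  module _ (1+1≈0 : HasCharacteristic2 R) where
    open Characteristic2 R 1+1≈0 using (x+x≈0)

    -- The two copies of `u` give the same term `t` in the first row, and `t + t` vanishes; all
    -- other choices keep both copies. Here the permanent behaves as a determinant.
    perm-repeat : ∀ n r u cs → perm n r (u ∷ u ∷ cs) ≈ 0#
    perm-repeat zero    r u cs = refl
    perm-repeat (suc n) r u cs = begin
      t + (t + pickSum (λ x xs → x r * perm n (suc r) (u ∷ u ∷ xs)) cs)
        ≈⟨ +-assoc _ _ _ ⟨
      t + t + pickSum (λ x xs → x r * perm n (suc r) (u ∷ u ∷ xs)) cs
        ≈⟨ +-cong (x+x≈0 t)
             (pickSum-zero (λ x xs → trans (*-congˡ (perm-repeat n (suc r) u xs)) (zeroʳ _)) cs) ⟩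
      0# + 0# ≈⟨ +-identityˡ 0# ⟩
      0#      ∎
      where
      t : Carrier
      t = u r * perm n (suc r) (u ∷ cs)

    perm-∈ : ∀ n r {u cs} → u ∈ cs → perm n r (u ∷ cs) ≈ 0#
    perm-∈ n r {u} u∈cs with ∈-∃++ u∈cs
    ... | xs , ys , ≡.refl = trans (perm-↭ n r (↭.prep u (shift u xs ys))) (perm-repeat n r u (xs ++ ys))

    -- The last column carries the factor `b k`, which is 1. The terms for the other columns repeat
    -- a column and vanish, so it may be replaced by the whole combination, which is the last unit
    -- vector.
    perm-column-operation : ∀ k (f : ℕ → Column) (b : ℕ → Carrier) →
      (∀ i → i < k → ∑ (suc k) (λ j → b j * f j i) ≈ 0#) →
      ∑ (suc k) (λ j → b j * f j k) ≈ 1# → b k ≈ 1# →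
      perm (suc k) 0 (applyUpTo f (suc k)) ≈ perm k 0 (applyUpTo f k)
    perm-column-operation k f b h e b-k = begin
      perm (suc k) 0 (applyUpTo f (suc k))
        ≡⟨ ≡.cong (perm (suc k) 0) (List.applyUpTo-∷ʳ f k) ⟨
      perm (suc k) 0 (applyUpTo f k ++ [ f k ])
        ≈⟨ perm-↭ (suc k) 0 (↭.trans (shift (f k) (applyUpTo f k) [])
             (↭.↭-reflexive (≡.cong (f k ∷_) (List.++-identityʳ _)))) ⟩
      perm (suc k) 0 (f k ∷ applyUpTo f k)
        ≈⟨ trans (*-congʳ b-k) (*-identityˡ _) ⟨
      b k * perm (suc k) 0 (f k ∷ applyUpTo f k)
        ≈⟨ ∑-last k (λ j l → trans (*-congˡ (perm-∈ (suc k) 0 (∈-applyUpTo⁺ f l))) (zeroʳ _)) ⟨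
      ∑ (suc k) (λ j → b j * perm (suc k) 0 (f j ∷ applyUpTo f k))
        ≈⟨ perm-∑ (suc k) 0 (suc k) b f _ ⟨
      perm (suc k) 0 ((λ i → ∑ (suc k) (λ j → b j * f j i)) ∷ applyUpTo f k)
        ≈⟨ perm-last-row k 0 (λ i → ∑ (suc k) (λ j → b j * f j i)) _
             (λ i l → trans (reflexive (≡.cong s (ℕ.+-identityʳ i))) (h i l))
             (trans (reflexive (≡.cong s (ℕ.+-identityʳ k))) e) ⟩
      perm k 0 (applyUpTo f k) ∎
      where
      s : ℕ → Carrier
      s i = ∑ (suc k) (λ j → b j * f j i)

-- Period doubling modulo 2

open ≡ using (refl; sym; trans; cong; cong₂; subst)
open Lemmas using (split; n<2^n; 2^≢0; factor-above; factor-below; zero-above)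

thueMorseProduct-top : ∀ m r → r < 2 ℕ.^ m →
  coeff (thueMorseProduct (suc m)) (2 ℕ.^ m ℕ.+ r) ≡ ℤ.- coeff (thueMorseProduct m) r
thueMorseProduct-top m r l = trans (factor-above (2 ℕ.^ m) {{2^≢0 m}} (thueMorseProduct m) r)
  (trans (cong (ℤ._- coeff (thueMorseProduct m) r) (zero-above m r)) (ℤ.+-identityˡ _))

-- This is the identity `P (m + 1) (x) = (1 − x) P m (x²)` read on coefficients. The definition adds
-- the factor of highest degree last, so `n` is split at the middle: the lower half is unchanged,
-- the upper half is a negated copy, and doubling respects the halves.
thueMorseProduct-double : ∀ m n → n < 2 ℕ.^ m →
  coeff (thueMorseProduct (suc m)) (2 ℕ.* n) ≡ coeff (thueMorseProduct m) n
  × coeff (thueMorseProduct (suc m)) (suc (2 ℕ.* n)) ≡ ℤ.- coeff (thueMorseProduct m) n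
thueMorseProduct-double zero    zero    _ = refl , refl
thueMorseProduct-double zero    (suc n) (ℕ.s≤s ())
thueMorseProduct-double (suc m) n l with split (2 ℕ.^ m) n
... | inj₁ l′ = trans (low (2 ℕ.* n) (ℕ.<-trans (ℕ.n<1+n _) odd<))
                  (trans (proj₁ (thueMorseProduct-double m n l′)) (sym low-n))
              , trans (low (suc (2 ℕ.* n)) odd<)
                  (trans (proj₂ (thueMorseProduct-double m n l′)) (cong ℤ.-_ (sym low-n)))
  where
  odd< : suc (2 ℕ.* n) < 2 ℕ.^ suc m
  odd< = subst (_≤ 2 ℕ.^ suc m) (ℕ.*-suc 2 n) (ℕ.*-monoʳ-≤ 2 l′)
  low : ∀ i → i < 2 ℕ.^ suc m →
    coeff (thueMorseProduct (2 ℕ.+ m)) i ≡ coeff (thueMorseProduct (suc m)) i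
  low i = factor-below (2 ℕ.^ suc m) {{2^≢0 (suc m)}} (thueMorseProduct (suc m)) i
  low-n : coeff (thueMorseProduct (suc m)) n ≡ coeff (thueMorseProduct m) n
  low-n = factor-below (2 ℕ.^ m) {{2^≢0 m}} (thueMorseProduct m) n l′
... | inj₂ eq = trans (cong (coeff (thueMorseProduct (2 ℕ.+ m))) eq-even)
                  (trans (thueMorseProduct-top (suc m) (2 ℕ.* r) (ℕ.<-trans (ℕ.n<1+n _) odd<))
                    (trans (cong ℤ.-_ (proj₁ (thueMorseProduct-double m r r<))) (sym top-n)))
              , trans (cong (coeff (thueMorseProduct (2 ℕ.+ m))) (trans (cong suc eq-even) (sym (ℕ.+-suc _ _))))
                  (trans (thueMorseProduct-top (suc m) (suc (2 ℕ.* r)) odd<)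
                    (cong ℤ.-_ (trans (proj₂ (thueMorseProduct-double m r r<)) (sym top-n))))
  where
  r : ℕ
  r = n ℕ.∸ 2 ℕ.^ m
  r< : r < 2 ℕ.^ m
  r< = ℕ.+-cancelˡ-< (2 ℕ.^ m) r (2 ℕ.^ m)
    (≡.subst₂ _<_ (sym eq) (cong (2 ℕ.^ m ℕ.+_) (ℕ.+-identityʳ _)) l)
  odd< : suc (2 ℕ.* r) < 2 ℕ.^ suc m
  odd< = subst (_≤ 2 ℕ.^ suc m) (ℕ.*-suc 2 r) (ℕ.*-monoʳ-≤ 2 r<)
  eq-even : 2 ℕ.* n ≡ 2 ℕ.^ suc m ℕ.+ 2 ℕ.* r
  eq-even = trans (cong (2 ℕ.*_) (sym eq)) (ℕ.*-distribˡ-+ 2 (2 ℕ.^ m) r)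
  top-n : coeff (thueMorseProduct (suc m)) n ≡ ℤ.- coeff (thueMorseProduct m) r
  top-n = trans (cong (coeff (thueMorseProduct (suc m))) (sym eq)) (thueMorseProduct-top m r r<)

module _ (n : ℕ) where
  private
    n<2^ : n < 2 ℕ.^ suc (2 ℕ.* n)
    n<2^ = ℕ.<-trans (n<2^n n) (ℕ.^-monoʳ-< 2 (ℕ.s≤s (ℕ.s≤s ℕ.z≤n)) (ℕ.s≤s (ℕ.m≤m+n n _)))
    stable : coeff (thueMorseProduct (suc (2 ℕ.* n))) n ≡ thueMorse n
    stable = thueMorse-stable n _ (ℕ.s≤s (ℕ.m≤m+n n _))

  thueMorse-even : thueMorse (2 ℕ.* n) ≡ thueMorse n
  -- Passing to a partial product with one more factor lets both parities use the same instance of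
  -- `thueMorseProduct-double`.
  thueMorse-even = trans (sym (thueMorse-stable (2 ℕ.* n) _ (ℕ.m<n⇒m<1+n (ℕ.n<1+n _))))
    (trans (proj₁ (thueMorseProduct-double (suc (2 ℕ.* n)) n n<2^)) stable)

  thueMorse-odd : thueMorse (suc (2 ℕ.* n)) ≡ ℤ.- thueMorse n
  thueMorse-odd = trans (proj₂ (thueMorseProduct-double (suc (2 ℕ.* n)) n n<2^)) (cong ℤ.-_ stable)

module _ (n : ℕ) where
  periodDoubling-even : periodDoubling (2 ℕ.* n) ≡ 1ℤ
  periodDoubling-even rewrite thueMorse-even n | thueMorse-odd n with thueMorse n | thueMorse-±1 n
  ... | _ | inj₁ refl = refl
  ... | _ | inj₂ refl = refl

  -- The signs compared are those of `- thueMorse n` and `thueMorse (suc n)`, which differ exactly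
  -- when `thueMorse n` and `thueMorse (suc n)` agree.
  periodDoubling-odd : parity ∣ periodDoubling (suc (2 ℕ.* n)) ∣ ≡ 1ℙ ℙ.+ parity ∣ periodDoubling n ∣
  periodDoubling-odd
    rewrite thueMorse-odd n
          | trans (cong thueMorse (sym (ℕ.*-suc 2 n))) (thueMorse-even (suc n))
    with thueMorse n | thueMorse-±1 n | thueMorse (suc n) | thueMorse-±1 (suc n)
  ... | _ | inj₁ refl | _ | inj₁ refl = refl
  ... | _ | inj₁ refl | _ | inj₂ refl = refl
  ... | _ | inj₂ refl | _ | inj₁ refl = refl
  ... | _ | inj₂ refl | _ | inj₂ refl = refl

-- Determinants of integer polynomials modulo 2

parity-⊖ : ∀ m n → parity ∣ m ⊖ n ∣ ≡ parity m ℙ.+ parity n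
parity-⊖ m       zero    = sym (ℙ.+-identityʳ (parity m))
parity-⊖ zero    (suc n) = refl
parity-⊖ (suc m) (suc n) = trans (cong (parity ∘ ∣_∣) (ℤ.[1+m]⊖[1+n]≡m⊖n m n))
  (trans (parity-⊖ m n) (trans (lemma (parity m) (parity n))
    (cong₂ ℙ._+_ (sym (parity-suc m)) (sym (parity-suc n)))))
  where
  parity-suc : ∀ n → parity (suc n) ≡ 1ℙ ℙ.+ parity n
  parity-suc = ℙ.+-homo-+ 1
  lemma : ∀ p r → p ℙ.+ r ≡ (1ℙ ℙ.+ p) ℙ.+ (1ℙ ℙ.+ r)
  lemma 0ℙ 0ℙ = refl
  lemma 0ℙ 1ℙ = refl
  lemma 1ℙ 0ℙ = refl
  lemma 1ℙ 1ℙ = refl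

par : ℤ → Parity
par a = parity ∣ a ∣

par-+ : ∀ a b → par (a ℤ.+ b) ≡ par a ℙ.+ par b
par-+ (+ m)    (+ n)    = ℙ.+-homo-+ m n
par-+ (+ m)    -[1+ n ] = parity-⊖ m (suc n)
par-+ -[1+ m ] (+ n)    = trans (parity-⊖ n (suc m)) (ℙ.+-comm (parity n) _)
par-+ -[1+ m ] -[1+ n ] = trans (cong (parity ∘ suc) (sym (ℕ.+-suc m n))) (ℙ.+-homo-+ (suc m) (suc n))

par-* : ∀ a b → par (a ℤ.* b) ≡ par a ℙ.* par b
par-* a b = trans (cong parity (ℤ.abs-* a b)) (ℙ.*-homo-* ∣ a ∣ ∣ b ∣)

par-neg : ∀ a → par (ℤ.- a) ≡ par a
par-neg a = cong parity (ℤ.∣-i∣≡∣i∣ a)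

parity-even⇒2∣ : ∀ n → parity n ≡ 0ℙ → 2 ℕ.∣ n
parity-even⇒2∣ zero          _ = 2 ℕ.∣0
parity-even⇒2∣ (suc (suc n)) e = ℕ.∣m∣n⇒∣m+n ℕ.∣-refl (parity-even⇒2∣ n e)

par-even⇒2∣ : ∀ a → par a ≡ 0ℙ → + 2 ℤ.∣ a
par-even⇒2∣ a = parity-even⇒2∣ ∣ a ∣

par-odd⇒Odd : ∀ a → par a ≡ 1ℙ → Odd a
par-odd⇒Odd a e (ℕ.divides m eq) = contradiction
  (trans (sym e) (trans (cong parity eq) (trans (ℙ.*-homo-* m 2) (ℙ.*-zeroʳ (parity m))))) λ ()

private module ℙ⟦q⟧ = PowerSeries (CommutativeRing.commutativeSemiring ℙ.+-*-commutativeRing)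
open ℙ⟦q⟧ using (Series; constant; q)
private
  R : CommutativeSemiring _ _
  R = ℙ⟦q⟧.commutativeSemiring
  module R = CommutativeSemiring R
open R using (_≈_; _+_; _*_; 0#; 1#)
open Permanent R
open FiniteSums R

1+1≈0 : HasCharacteristic2 R
1+1≈0 zero    = refl
1+1≈0 (suc n) = refl

open Characteristic2 R 1+1≈0 using (module PeriodDoublingResolvent; solve; _:*_; _:+_; _:=_)

-- Modulo 2, the series f is qⁿ p(1/q).
record Reversal (n : ℕ) (p : Poly) (f : Series) : Set where
  constructor reversal
  field
    coefficients  : ∀ i j → i ℕ.+ j ≡ n → par (coeff p i) ≡ f j
    degree-p : ∀ i → n < i → coeff p i ≡ 0ℤ
    degree-f : ∀ j → n < j → f j ≡ 0ℙ

open Reversal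

Reversal-resp-≈ : ∀ {n p f g} → f ≈ g → Reversal n p f → Reversal n p g
Reversal-resp-≈ f≈g (reversal h dp df) = reversal
  (λ i j e → trans (h i j e) (f≈g j)) dp (λ j l → trans (sym (f≈g j)) (df j l))

Reversal-0 : ∀ n → Reversal n [] 0#
Reversal-0 n = reversal (λ _ _ _ → refl) (λ _ _ → refl) (λ _ _ → refl)

Reversal-+ : ∀ {n p p′ f f′} → Reversal n p f → Reversal n p′ f′ → Reversal n (p +ₚ p′) (f + f′)
Reversal-+ {p = p} {p′} (reversal h dp df) (reversal h′ dp′ df′) = reversal
  (λ i j e → trans (cong par (Lemmas.coeff-+ p p′ i))
    (trans (par-+ (coeff p i) (coeff p′ i)) (cong₂ ℙ._+_ (h i j e) (h′ i j e))))
  (λ i l → trans (Lemmas.coeff-+ p p′ i) (cong₂ ℤ._+_ (dp i l) (dp′ i l)))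
  (λ j l → cong₂ ℙ._+_ (df j l) (df′ j l))

polySum : ∀ {n} → (Fin n → Poly) → Poly
polySum = RawSemiringDefs.sum (RawRing.rawSemiring polyRawRing)

-- Choosing the `j`-th element of a tabulated list leaves the list tabulated along `punchIn j`, so
-- the Laplace sum and `pickSum` match term by term.
Reversal-pickSum : ∀ {a} {A : Set a} {n m} (F : A → List A → Series)
  (p : Fin (suc m) → Poly) (c : Fin (suc m) → A) →
  (∀ j → Reversal n (p j) (F (c j) (tabulate (c ∘ punchIn j)))) →
  Reversal n (polySum p) (pickSum F (tabulate c))
Reversal-pickSum {n = n} {m = zero}  F p c h = Reversal-+ (h zero) (Reversal-0 n)
Reversal-pickSum {m = suc m} F p c h = Reversal-+ (h zero)
  (Reversal-pickSum (λ x xs → F x (c zero ∷ xs)) (p ∘ suc) (c ∘ suc) (h ∘ suc))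

coeff-const* : ∀ a p i → coeff ([ a ] *ₚ p) i ≡ a ℤ.* coeff p i
coeff-const* a p i = trans (Lemmas.coeff-∷* a [] p i)
  (trans (cong (λ z → a ℤ.* coeff p i ℤ.+ z) (nil i)) (ℤ.+-identityʳ _))
  where
  nil : ∀ i → coeff (0ℤ ∷ []) i ≡ 0ℤ
  nil zero    = refl
  nil (suc i) = refl

Reversal-unit : ∀ {n p f} a → par a ≡ 1ℙ → Reversal n p f → Reversal n ([ a ] *ₚ p) f
Reversal-unit {p = p} a odd-a (reversal h dp df) = reversal
  (λ i j e → trans (cong par (coeff-const* a p i))
    (trans (par-* a (coeff p i)) (trans (cong (ℙ._* _) odd-a) (h i j e))))
  (λ i l → trans (coeff-const* a p i) (trans (cong (a ℤ.*_) (dp i l)) (ℤ.*-zeroʳ a)))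
  df

-- A sign is a single odd coefficient and so acts trivially modulo 2; this turns the determinant
-- into a permanent.
sign-constant : ∀ j → ∃[ a ] (((-ₚ [ 1ℤ ]) ^ₚ j ≡ [ a ]) × par a ≡ 1ℙ)
sign-constant zero    = 1ℤ , refl , refl
sign-constant (suc j) with sign-constant j
... | a , e , odd-a = -1ℤ ℤ.* a ℤ.+ 0ℤ , cong ((-ₚ [ 1ℤ ]) *ₚ_) e ,
  trans (par-+ (-1ℤ ℤ.* a) 0ℤ) (trans (ℙ.+-identityʳ _) (trans (par-* -1ℤ a) odd-a))

Reversal-sign : ∀ {n p f} j → Reversal n p f →
  Reversal n (((-ₚ [ 1ℤ ]) ^ₚ j) *ₚ p) f
Reversal-sign {n} {p} {f} j h with sign-constant j
... | a , e , odd-a = subst (λ s → Reversal n (s *ₚ p) f) (sym e) (Reversal-unit a odd-a h)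

-- Modulo 2, `g` is `q l(1/q)` for an entry `l` of degree at most 1. It is recorded through its
-- effect on products, since each row of the expansion multiplies by one entry and raises `n` by
-- one.
record LinearReversal (l : Poly) (g : Series) : Set where
  constructor linearReversal
  field
    Reversal-* : ∀ {n p f} → Reversal n p f → Reversal (suc n) (l *ₚ p) (g * f)

open LinearReversal

LinearReversal-const : ∀ a → LinearReversal [ a ] (q * constant (par a))
Reversal-* (LinearReversal-const a) {n} {p} {f} (reversal h dp df) = reversal
  coeffs
  (λ i l → trans (coeff-const* a p i)
    (trans (cong (a ℤ.*_) (dp i (ℕ.<-trans (ℕ.n<1+n n) l))) (ℤ.*-zeroʳ a)))
  (λ { (suc j) (s≤s l) → trans (series-suc j) (trans (cong (par a ℙ.*_) (df j l)) (ℙ.*-zeroʳ (par a))) })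
  where
  series : q * constant (par a) * f ≈ q * (constant (par a) * f)
  series = R.*-assoc q (constant (par a)) f
  series-suc : ∀ j → (q * constant (par a) * f) (suc j) ≡ par a ℙ.* f j
  series-suc j = trans (series (suc j))
    (trans (ℙ⟦q⟧.q*-suc (constant (par a) * f) j) (ℙ⟦q⟧.*-constant (par a) f j))
  coeffs : ∀ i j → i ℕ.+ j ≡ suc n → par (coeff ([ a ] *ₚ p) i) ≡ (q * constant (par a) * f) j
  coeffs i zero e = trans (cong par (trans (coeff-const* a p i)
      (trans (cong (a ℤ.*_) (dp i (subst (n <_) (trans (sym e) (ℕ.+-identityʳ i)) (ℕ.n<1+n n))))
        (ℤ.*-zeroʳ a))))
    (sym (trans (series 0) (ℙ⟦q⟧.q*-zero (constant (par a) * f))))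
  coeffs i (suc j) e = trans (cong par (coeff-const* a p i)) (trans (par-* a (coeff p i))
    (trans (cong (par a ℙ.*_) (h i j (ℕ.suc-injective (trans (sym (ℕ.+-suc i j)) e))))
      (sym (series-suc j))))

LinearReversal-X : ∀ a → par a ≡ 1ℙ → LinearReversal (const a *ₚ X) 1#
Reversal-* (LinearReversal-X a odd-a) {n} {p} {f} (reversal h dp df) =
  Reversal-resp-≈ (R.sym (R.*-identityˡ f)) (reversal
  (λ { zero j e → trans (cong par coeff-zero) (sym (df j (subst (n <_) (sym e) (ℕ.n<1+n n))))
     ; (suc i) j e → trans (cong par (coeff-suc i)) (trans (par-* a (coeff p i))
         (trans (cong (ℙ._* par (coeff p i)) odd-a) (h i j (ℕ.suc-injective e)))) })
  (λ { (suc i) (s≤s l) → trans (coeff-suc i) (trans (cong (a ℤ.*_) (dp i l)) (ℤ.*-zeroʳ a)) })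
  (λ j l → df j (ℕ.<-trans (ℕ.n<1+n n) l)))
  where
  a*0+0 : a ℤ.* 0ℤ ℤ.+ 0ℤ ≡ 0ℤ
  a*0+0 = trans (ℤ.+-identityʳ _) (ℤ.*-zeroʳ a)
  drop-zero : ∀ z w → (a ℤ.* 0ℤ ℤ.+ 0ℤ) ℤ.* z ℤ.+ w ≡ w
  drop-zero z w = trans (cong (λ x → x ℤ.* z ℤ.+ w) a*0+0) (ℤ.+-identityˡ w)
  coeff-zero : coeff ((const a *ₚ X) *ₚ p) 0 ≡ 0ℤ
  coeff-zero = trans (Lemmas.coeff-∷* (a ℤ.* 0ℤ ℤ.+ 0ℤ) [ a ℤ.* 1ℤ ] p 0) (drop-zero (coeff p 0) 0ℤ)
  coeff-suc : ∀ i → coeff ((const a *ₚ X) *ₚ p) (suc i) ≡ a ℤ.* coeff p i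
  coeff-suc i = trans (Lemmas.coeff-∷* (a ℤ.* 0ℤ ℤ.+ 0ℤ) [ a ℤ.* 1ℤ ] p (suc i)) (trans (drop-zero (coeff p (suc i)) _)
    (trans (coeff-const* (a ℤ.* 1ℤ) p i) (cong (ℤ._* coeff p i) (ℤ.*-identityʳ a))))

LinearReversal-resp-≈ : ∀ {l g g′} → g ≈ g′ → LinearReversal l g → LinearReversal l g′
Reversal-* (LinearReversal-resp-≈ e h) r = Reversal-resp-≈ (R.*-congʳ e) (Reversal-* h r)

-- Minors in `det` renumber their rows from zero, whereas `perm` keeps whole columns and advances
-- `r`; the offset `r + toℕ i` reconciles the two.
Reversal-det : ∀ n r (M : Fin n → Fin n → Poly) (c : Fin n → Column) →
  (∀ i j → LinearReversal (M i j) (c j (r ℕ.+ toℕ i))) →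
  Reversal n (det polyRawRing M) (perm n r (tabulate c))
Reversal-det zero    r M c h = reversal
  (λ { zero zero _ → refl }) (λ { (suc i) _ → refl }) (λ { (suc j) _ → refl })
Reversal-det (suc n) r M c h = Reversal-pickSum (λ u us → u r * perm n (suc r) us)
  (λ j → _) c
  (λ j → Reversal-sign (toℕ j)
    (Reversal-* (subst (λ s → LinearReversal (M zero j) (c j s)) (ℕ.+-identityʳ r) (h zero j))
      (Reversal-det n (suc r) (λ i s → M (suc i) (punchIn j s)) (c ∘ punchIn j)
        (λ i s → subst (λ t → LinearReversal (M (suc i) (punchIn j s)) (c (punchIn j s) t))
          (ℕ.+-suc r (toℕ i)) (h (suc i) (punchIn j s))))))

-- The last column of the resolvent over the power series ring

indicator : ℕ → ℕ → Parity
indicator i j = if does (i ℕ.≟ j) then 1ℙ else 0ℙ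

indicator-≡ : ∀ i → indicator i i ≡ 1ℙ
indicator-≡ i = cong (if_then 1ℙ else 0ℙ) (dec-true (i ℕ.≟ i) refl)

indicator-≢ : ∀ {i j} → i ≢ j → indicator i j ≡ 0ℙ
indicator-≢ {i} {j} i≢j = cong (if_then 1ℙ else 0ℙ) (dec-false (i ℕ.≟ j) i≢j)

constant-0 : constant 0ℙ ≈ 0#
constant-0 zero    = refl
constant-0 (suc n) = refl

constant-+ : ∀ a b → constant (a ℙ.+ b) ≈ constant a + constant b
constant-+ a b zero    = refl
constant-+ a b (suc n) = refl

∑-indicator : ∀ n (y : ℕ → Series) {i} → i < n → ∑ n (λ j → y j * constant (indicator i j)) ≈ y i
∑-indicator (suc n) y {i} i<1+n with i ℕ.≟ n
... | yes refl = R.trans (∑-last n (λ j l → R.trans (R.*-congˡ (R.trans (R.reflexive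
        (cong constant (indicator-≢ (ℕ.>⇒≢ l)))) constant-0)) (R.zeroʳ (y j))))
      (R.trans (R.*-congˡ (R.reflexive (cong constant (indicator-≡ n)))) (R.*-identityʳ (y n)))
... | no i≢n = R.trans (R.+-cong (∑-indicator n y (ℕ.≤∧≢⇒< (ℕ.≤-pred i<1+n) i≢n))
        (R.trans (R.*-congˡ (R.trans (R.reflexive (cong constant (indicator-≢ i≢n))) constant-0)) (R.zeroʳ (y n))))
      (R.+-identityʳ (y i))

private
  δ : ℕ → Parity
  δ n = par (periodDoubling n)

  d : ℕ → Series
  d n = constant (δ n)

d-even : ∀ n → d (2 ℕ.* n) ≈ 1#
d-even n = R.reflexive (cong (constant ∘ par) (periodDoubling-even n))

d-odd : ∀ n → d (suc (2 ℕ.* n)) ≈ 1# + d n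
d-odd n = R.trans (R.reflexive (cong constant (periodDoubling-odd n))) (constant-+ 1ℙ (δ n))

1+q*-regular : ∀ f g → (1# + q * f) * g ≈ 0# → g ≈ 0#
1+q*-regular f g = ℙ⟦q⟧.unit-regular (1# + q * f) (cong (1ℙ ℙ.+_) (ℙ⟦q⟧.q*-zero f)) g

open PeriodDoublingResolvent d d-even d-odd q 1+q*-regular

private
  module ℙ∑ = FiniteSums (CommutativeRing.commutativeSemiring ℙ.+-*-commutativeRing)

module Neumann (k : ℕ) where
  below : ℕ → Parity
  below i = if does (i ℕ.≤? k) then 1ℙ else 0ℙ

  -- The system reads `y = e_k + q A y`, so each coefficient in `q` is `A` applied to the preceding
  -- one. In `next` the extra summand cancels the unit diagonal, and `below` cuts off the indices
  -- beyond `k`.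
  coefficient next : ℕ → ℕ → Parity
  coefficient zero    i = indicator i k
  coefficient (suc t) i = below i ℙ.* next t i
  next t i = coefficient t i ℙ.+ ℙ∑.∑ (suc k) (λ j → δ (i ℕ.+ j) ℙ.* coefficient t j)

  -- y = ∑ₜ qᵗ Aᵗ eₖ, truncated to the indices i ≤ k
  y : ℕ → Series
  y i t = coefficient t i

  y-above : ∀ i → k < i → y i ≈ 0#
  y-above i l zero    = indicator-≢ (ℕ.>⇒≢ l)
  y-above i l (suc t) = cong (λ b → (if b then 1ℙ else 0ℙ) ℙ.* next t i) (dec-false (i ℕ.≤? k) (ℕ.<⇒≱ l))

  ∑-coefficient : ∀ n i t → ∑ n (λ j → d (i ℕ.+ j) * y j) t
    ≡ ℙ∑.∑ n (λ j → δ (i ℕ.+ j) ℙ.* coefficient t j)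
  ∑-coefficient zero    i t = refl
  ∑-coefficient (suc n) i t = cong₂ ℙ._+_ (∑-coefficient n i t) (ℙ⟦q⟧.*-constant (δ (i ℕ.+ n)) (y n) t)

  row-y : ∀ i → i ≤ k → row (suc k) y i ≈ constant (indicator i k)
  row-y i l zero = trans (cong (indicator i k ℙ.+_)
      (ℙ⟦q⟧.q*-zero (y i + ∑ (suc k) (λ j → d (i ℕ.+ j) * y j)))) (ℙ.+-identityʳ _)
  row-y i l (suc t) = trans
    (cong₂ ℙ._+_
      (cong (λ b → (if b then 1ℙ else 0ℙ) ℙ.* next t i) (dec-true (i ℕ.≤? k) l))
      (trans (ℙ⟦q⟧.q*-suc (y i + ∑ (suc k) (λ j → d (i ℕ.+ j) * y j)) t)
        (cong (coefficient t i ℙ.+_) (∑-coefficient (suc k) i t))))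
    -- Beyond the constant term, `y i` and the `q`-part of the row both contribute `next t i`.
    (ℙ.p+p≡0ℙ (next t i))

  row-y-k : row (suc k) y k ≈ 1#
  row-y-k = R.trans (row-y k ℕ.≤-refl) (R.reflexive (cong constant (indicator-≡ k)))

  row-y-below : ∀ i → i < k → row (suc k) y i ≈ 0#
  row-y-below i l = R.trans (row-y i (ℕ.<⇒≤ l))
    (R.trans (R.reflexive (cong constant (indicator-≢ (ℕ.<⇒≢ l)))) constant-0)

  ∑y≈1 : ∑ (suc k) y ≈ 1#
  ∑y≈1 = R.trans (sum≈last k 0# y y-above row-y-below (R.trans row-y-k (R.sym 1+q0))) 1+q0
    where
    1+q0 : 1# + q * 0# ≈ 1#
    1+q0 = R.trans (R.+-congˡ {1#} (R.zeroʳ q)) (R.+-identityʳ 1#)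

  -- The last row is 1, so `row-pairing` equates the last entry with the square of the sum of `y`,
  -- which is 1.
  y-k : y k ≈ 1#
  y-k = R.trans (R.sym (R.trans (R.*-congˡ row-y-k) (R.*-identityʳ (y k))))
    (R.trans (row-pairing k y row-y-below) (R.trans (R.*-cong ∑y≈1 ∑y≈1) (R.*-identityˡ 1#)))

-- On the diagonal the bracket is `1 + 1`, so the entry is 1, the reversal of an odd multiple of
-- `X`; off the diagonal it is `q` times a value of `d`.
column : ℕ → Column
column j i = constant (indicator i j) + q * (constant (indicator i j) + d (i ℕ.+ j))

∑-column : ∀ n y i → i < n → ∑ n (λ j → y j * column j i) ≈ row n y i
∑-column n y i l = begin
  ∑ n (λ j → y j * (e j + q * (e j + d (i ℕ.+ j))))
    ≈⟨ ∑-cong n (λ j _ → solve 4 (λ y e q d → y :* (e :+ q :* (e :+ d)) := y :* e :+ q :* (y :* e :+ d :* y))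
         R.refl (y j) (e j) q (d (i ℕ.+ j))) ⟩
  ∑ n (λ j → y j * e j + q * (y j * e j + d (i ℕ.+ j) * y j))
    ≈⟨ R.trans (∑-distrib-+ n ye (λ j → q * (ye j + dy j))) (R.+-cong (∑-indicator n y l)
         (R.trans (*-distribˡ-∑ n q (λ j → ye j + dy j)) (R.*-congˡ {q}
           (R.trans (∑-distrib-+ n ye dy) (R.+-congʳ {∑ n dy} (∑-indicator n y l)))))) ⟩
  row n y i ∎
  where
  open import Relation.Binary.Reasoning.Setoid R.setoid
  e ye dy : ℕ → Series
  e j  = constant (indicator i j)
  ye j = y j * e j
  dy j = d (i ℕ.+ j) * y j

perm-column : ∀ k → perm k 0 (applyUpTo column k) ≈ 1#
perm-column zero    = R.refl
perm-column (suc k) = R.trans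
  (perm-column-operation 1+1≈0 k column y
    (λ i l → R.trans (∑-column (suc k) y i (ℕ.m<n⇒m<1+n l)) (row-y-below i l))
    (R.trans (∑-column (suc k) y k ℕ.≤-refl) row-y-k) y-k)
  (perm-column k)
  where open Neumann k

-- The determinant of the period-doubling sequence modulo 2

LinearReversal-entry : ∀ {k} (i j : Fin k) →
  LinearReversal (tHankelMatrix periodDoubling k i j) (column (toℕ j) (toℕ i))
LinearReversal-entry i j with i Fin.≟ j
... | yes refl = LinearReversal-resp-≈
  (R.sym (R.trans (R.+-cong (R.reflexive e) (R.trans (R.*-congˡ (R.trans (R.+-cong (R.reflexive e)
     (d-2* (toℕ i))) 1+1≈0)) (R.zeroʳ q))) (R.+-identityʳ 1#)))
  -- The coefficient at `0` of the series identity `d-2*` says that the diagonal value is odd.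
  (LinearReversal-X (periodDoubling (toℕ i ℕ.+ toℕ i)) (d-2* (toℕ i) 0))
  where
  e : constant (indicator (toℕ i) (toℕ i)) ≡ 1#
  e = cong constant (indicator-≡ (toℕ i))
... | no i≢j = LinearReversal-resp-≈
  (R.sym (R.trans (R.+-cong e (R.*-congˡ (R.trans (R.+-congʳ e) (R.+-identityˡ _)))) (R.+-identityˡ _)))
  (LinearReversal-const (periodDoubling (toℕ i ℕ.+ toℕ j)))
  where
  e : constant (indicator (toℕ i) (toℕ j)) ≈ 0#
  e = R.trans (R.reflexive (cong constant (indicator-≢ (i≢j ∘ Fin.toℕ-injective)))) constant-0

tabulate-toℕ : ∀ {a} {A : Set a} n (f : ℕ → A) → tabulate {n = n} (f ∘ toℕ) ≡ applyUpTo f n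
tabulate-toℕ zero    f = refl
tabulate-toℕ (suc n) f = cong (f 0 ∷_) (tabulate-toℕ n (f ∘ suc))

-- The series 1 is the reversal of `X ^ₚ k` at level `k`, so this is already the congruence,
-- together with the degree bound over the integers.
Reversal-tHankelDet : ∀ k → Reversal k (tHankelDet periodDoubling k) 1#
Reversal-tHankelDet k = Reversal-resp-≈
  (R.trans (R.reflexive (cong (perm k 0) (tabulate-toℕ k column))) (perm-column k))
  (Reversal-det k 0 (tHankelMatrix periodDoubling k) (column ∘ toℕ) LinearReversal-entry)

coeff-X^-same : ∀ k → coeff (X ^ₚ k) k ≡ 1ℤ
coeff-X^-same k = trans (Lemmas.coeff-X^ k k) (same k)
  where
  same : ∀ k → coeff (Lemmas.mono 1ℤ k) k ≡ 1ℤ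
  same zero    = refl
  same (suc k) = same k

coeff-X^-other : ∀ k {i} → i ≢ k → coeff (X ^ₚ k) i ≡ 0ℤ
coeff-X^-other k {i} i≢k = trans (Lemmas.coeff-X^ k i) (other k i i≢k)
  where
  other : ∀ k i → i ≢ k → coeff (Lemmas.mono 1ℤ k) i ≡ 0ℤ
  other zero    zero    h = contradiction refl h
  other zero    (suc i) h = refl
  other (suc k) zero    h = refl
  other (suc k) (suc i) h = other k i (h ∘ cong suc)

theorem1p2 : (k : ℕ) → 1 ≤ k →
    HasDegree (tHankelDet periodDoubling k) k
    × (∀ i → Odd (coeff (tHankelDet periodDoubling k) i) ⇔ i ≡ k)
    × (tHankelDet periodDoubling k ≡ X ^ₚ k [mod + 2 ])
theorem1p2 k _ =
  -- The top coefficient is odd, hence nonzero; the vanishing above it in `degree-p` is exact and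
  -- not only modulo 2.
  ((λ e → contradiction (trans (sym leading) (cong par e)) λ ()) , degree-p H)
  , (λ i → mk⇔ (odd⇒leading i) λ { refl → par-odd⇒Odd (coeff P k) leading })
  , congruent
  where
  P : Poly
  P = tHankelDet periodDoubling k

  H : Reversal k P 1#
  H = Reversal-tHankelDet k

  leading : par (coeff P k) ≡ 1ℙ
  leading = coefficients H k 0 (ℕ.+-identityʳ k)

  other : ∀ i → i ≢ k → par (coeff P i) ≡ 0ℙ
  other i i≢k with ℕ.<-≤-connex k i
  ... | inj₁ k<i = cong par (degree-p H i k<i)
  ... | inj₂ i≤k with k ℕ.∸ i in eq
  ...   | zero  = contradiction (ℕ.≤-antisym i≤k (ℕ.m∸n≡0⇒m≤n eq)) i≢k
  -- An index below `k` corresponds to a positive index in the series `1#`, where the coefficient is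
  -- zero.
  ...   | suc j = coefficients H i (suc j) (trans (cong (i ℕ.+_) (sym eq)) (ℕ.m+[n∸m]≡n i≤k))

  odd⇒leading : ∀ i → Odd (coeff P i) → i ≡ k
  odd⇒leading i odd-i with i ℕ.≟ k
  ... | yes i≡k = i≡k
  ... | no  i≢k = contradiction (par-even⇒2∣ (coeff P i) (other i i≢k)) odd-i

  congruent : P ≡ X ^ₚ k [mod + 2 ]
  congruent i = par-even⇒2∣ (coeff P i ℤ.- coeff (X ^ₚ k) i) (trans (par-+ (coeff P i) _)
    (trans (cong (par (coeff P i) ℙ.+_) (par-neg (coeff (X ^ₚ k) i))) cancel))
    where
    cancel : par (coeff P i) ℙ.+ par (coeff (X ^ₚ k) i) ≡ 0ℙ
    cancel with i ℕ.≟ k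
    ... | yes refl = cong₂ ℙ._+_ leading (cong par (coeff-X^-same k))
    ... | no i≢k   = cong₂ ℙ._+_ (other i i≢k) (cong par (coeff-X^-other k i≢k))
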